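{- Let $r,s,t\ge 0$ be integers. For each $1\le i\le r$ let $p_i$ be a prime with $p_i = a_i^2+b_i^2 \equiv 1 \pmod 8$ for some integers $a_i,b_i$ such that both $a_i+b_i$ and $a_i-b_i$ lie in $\{8m\pm 1 \mid m\in\mathbb{Z}\}$; let $p_{r+1},\dots,p_{r+s}$ be primes congruent to $7$ modulo $8$; let $q_1,\dots,q_t$ be distinct primes congruent to $3$ modulo $8$; and let $k_1,\dots,k_{r+s}$ be non-negative integers. Then $$64\, p_1^{k_1}\cdots p_r^{k_r}\, p_{r+1}^{k_{r+1}}\cdots p_{r+s}^{k_{r+s}} \notin S(16) \quad\text{and}\quad 64\, p_1^{k_1}\cdots p_r^{k_r}\, p_{r+1}^{k_{r+1}}\cdots p_{r+s}^{k_{r+s}}\, q_1\cdots q_t \notin S(16).$$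
   Context: $S(16)$ is the set of all values $D(a_0,\dots,a_{15})$ with $a_i\in\mathbb{Z}$, where $D(a_0,\dots,a_{15})$ is the determinant of the $16\times16$ circulant matrix whose $(i,j)$ entry ($0\le i,j\le15$) is $a_{(i-j)\bmod 16}$. -}

module Defs where

open import Data.Nat as ℕ using (ℕ; zero; suc)
open import Data.Nat.DivMod using (_mod_)
open import Data.Nat.Primality using (Prime)
open import Data.Fin using (Fin; zero; suc; toℕ; punchIn)
open import Data.Integer as ℤ using (ℤ; +_; _+_; _-_; _*_; -_)
open import Data.Product using (Σ; ∃; _×_; _,_)
open import Data.Sum using (_⊎_)
open import Relation.Binary.PropositionalEquality using (_≡_)
open import Relation.Nullary using (¬_)

Matrix : ℕ → Set
Matrix n = Fin n → Fin n → ℤ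

sumFin : ∀ {n} → (Fin n → ℤ) → ℤ
sumFin {zero}  f = + 0
sumFin {suc n} f = f zero + sumFin (λ i → f (suc i))

prodFinℕ : ∀ {n} → (Fin n → ℕ) → ℕ
prodFinℕ {zero}  f = 1
prodFinℕ {suc n} f = f zero ℕ.* prodFinℕ (λ i → f (suc i))

sign : ℕ → ℤ
sign zero = + 1
sign (suc k) = - sign k

det : ∀ {n} → Matrix n → ℤ
det {zero}  M = + 1
det {suc n} M =
  sumFin (λ j → sign (toℕ j) * (M zero j * det (λ i k → M (suc i) (punchIn j k))))

circulant : ∀ n → (Fin (suc n) → ℤ) → Matrix (suc n)
circulant n a i j = a ((toℕ i ℕ.+ (suc n ℕ.∸ toℕ j)) mod (suc n))

D16 : (Fin 16 → ℤ) → ℤ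
D16 a = det (circulant 15 a)

InS16 : ℤ → Set
InS16 x = ∃ λ (a : Fin 16 → ℤ) → D16 a ≡ x

Is8m±1 : ℤ → Set
Is8m±1 x = ∃ λ (m : ℤ) → (x ≡ + 8 * m + + 1) ⊎ (x ≡ + 8 * m - + 1)

SpecialPrime : ℕ → Set
SpecialPrime p = Prime p × (p ℕ.% 8 ≡ 1) ×
  (∃ λ (a : ℤ) → ∃ λ (b : ℤ) → (+ p ≡ a * a + b * b) × Is8m±1 (a + b) × Is8m±1 (a - b))

{-# OPTIONS --safe #-}

-- Let f be the polynomial with coefficients a. With f(x) f(-x) = g(x²), the matrix of f times that
-- of f(-x) consists of two interleaved copies of the 8 × 8 circulant of g, and f(-x) has the same
-- determinant as f, so D16(f)² = D8(g)². Iterating, D16(f) is up to sign the product of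
-- n₁n₂ = f(1) f(-1) and the norms of f(i), f(ζ₈), f(ζ₁₆), each written as x² + y² by descending to ℤ[i].
--
-- If the product is 64 · odd, then each of these norms is 2m with m odd. The hypotheses on the
-- primes force x, y ≡ ±1 mod 8 whenever x² + y² = 2m with m an odd divisor of the product: divide
-- x + iy by the prime factors of m (a prime ≡ 3 mod 8 cannot occur, as it would divide m twice).
-- Modulo 16 and 8 these congruences, together with n₁n₂ ≡ 8 mod 16, say that a certain quadratic
-- form in the coefficients of f mod x⁸ + 1 is both even and odd.

module Submission where

open import Defs
open import Data.Empty using (⊥)
open import Data.Fin using (Fin; zero; suc; toℕ; fromℕ<; inject₁; punchIn; punchOut; pinch; combine; remQuot; finToFun; funToFin; splitAt; join; _↑ˡ_; _↑ʳ_)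
open import Data.Fin.Patterns
import Data.Fin.Properties as Fin
open import Data.Integer using (ℤ; +_; -[1+_]; _+_; _-_; _*_; -_; ∣_∣; _%ℕ_; _/ℕ_)
import Data.Integer.DivMod as ℤ
open import Data.Integer.Divisibility.Signed using (divides; _∣?_; ∣⇒∣ᵤ; ∣ᵤ⇒∣; ∣m∣n⇒∣m-n; ∣m+n∣n⇒∣m; ∣n⇒∣m*n; ∣m⇒∣m*n) renaming (_∣_ to infix 4 _∣ℤ_)
import Data.Integer.Properties as ℤ
open import Data.Integer.Solver using (module +-*-Solver)
open import Data.Integer.Tactic.RingSolver using (solve-∀)
import Data.List as List
import Data.List.Relation.Unary.All as All
open import Data.Nat as ℕ using (ℕ; zero; suc; _≤_; _<_; z≤n; s≤s; _^_; _%_)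
open import Data.Nat.Coprimality using (Coprime; coprime-Bézout)
import Data.Nat.DivMod as ℕ
import Data.Nat.Divisibility as ℕ
open import Data.Nat.GCD using (module Bézout)
open import Data.Nat.Induction using (<-rec)
open import Data.Nat.Primality using (Prime; euclidsLemma; prime⇒irreducible; prime⇒nonZero; prime⇒nonTrivial; ¬prime[1]; prime[2])
open import Data.Nat.Primality.Factorisation using (factorise)
import Data.Nat.Properties as ℕ
open import Data.Nat.Tactic.RingSolver using () renaming (solve-∀ to solveℕ-∀)
open import Data.Product using (∃; ∃₂; _×_; _,_; proj₁; proj₂)
open import Data.Sum as Sum using (_⊎_; inj₁; inj₂; [_,_]′)
open import Data.Sum.Properties using (inj₁-injective; inj₂-injective)
open import Data.Vec using (tabulate)
open import Data.Vec.Functional using (_∷_; tail; insertAt; removeAt)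
open import Function using (_∘_; id; _↔_; Inverse; mk↔ₛ′)
open import Function.Definitions using (Injective)
open import Relation.Binary.Definitions using (tri<; tri≈; tri>)
open import Relation.Binary.PropositionalEquality
open import Relation.Nullary using (¬_; Dec; yes; no; contradiction)
open import Relation.Nullary.Decidable using (from-yes; from-no; map′; _→-dec_; _⊎-dec_; ¬?)
open +-*-Solver using (Polynomial; prove; var; con; _:+_; _:*_; _:-_)

-- Alternating multilinear forms and determinants

-- Working with squares avoids complex eigenvalues: no circulant is ever diagonalised, and the sign
-- that is lost is harmless because 64n and -64n are excluded alike. All that this asks of `det` is
-- a product rule and a block rule. Both come from one fact: an alternating multilinear form is its
-- value at the identity times `det`.
--
-- The quadratic form arises as follows. Let s and d be the coefficients of f modulo x⁴ - 1 and x⁴ +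
-- 1. Given the residues at i, n₁n₂ ≡ 8 mod 16 says s₀s₂ - s₁s₃ ≡ 2 mod 4. The residues at ζ₈ say
-- d₀d₂ ≡ d₁d₃ mod 4. The expressions s₀s₂ - s₁s₃ and d₀d₂ - d₁d₃ differ mod 4 by 2 · `cross`, so
-- `cross` is odd. It depends on f only modulo 2, where x⁸ - 1 and x⁸ + 1 coincide, so it can be
-- computed from f modulo x⁸ + 1; there the condition used at ζ₈, applied to the norm of f(ζ₁₆) in
-- ℤ[ζ₈], makes it even.

Row : ℕ → Set
Row m = Fin m → ℤ

sum-cong : ∀ {n} {f g : Fin n → ℤ} → (∀ i → f i ≡ g i) → sumFin f ≡ sumFin g
sum-cong {zero}  e = refl
sum-cong {suc n} e = cong₂ _+_ (e zero) (sum-cong (e ∘ suc))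

sum-zero : ∀ {n} {f : Fin n → ℤ} → (∀ i → f i ≡ + 0) → sumFin f ≡ + 0
sum-zero {zero}  e = refl
sum-zero {suc n} e = cong₂ _+_ (e zero) (sum-zero (e ∘ suc))

sum-linear : ∀ {n} c (f g : Fin n → ℤ) →
             sumFin (λ i → c * f i + g i) ≡ c * sumFin f + sumFin g
sum-linear {zero}  c f g = ring c
  where
  ring : ∀ c → + 0 ≡ c * + 0 + + 0
  ring = solve-∀
sum-linear {suc n} c f g =
  trans (cong₂ _+_ (refl {x = c * f zero + g zero}) (sum-linear c (f ∘ suc) (g ∘ suc)))
        (ring c (f zero) (g zero) _ _)
  where
  ring : ∀ c x y s t → c * x + y + (c * s + t) ≡ c * (x + s) + (y + t)
  ring = solve-∀

sum-+ : ∀ {n} (f g : Fin n → ℤ) → sumFin (λ i → f i + g i) ≡ sumFin f + sumFin g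
sum-+ f g = trans (sum-cong λ i → cong (_+ g i) (sym (ℤ.*-identityˡ (f i))))
  (trans (sum-linear (+ 1) f g) (cong (_+ sumFin g) (ℤ.*-identityˡ (sumFin f))))

sum-*ˡ : ∀ {n} c (f : Fin n → ℤ) → sumFin (λ i → c * f i) ≡ c * sumFin f
sum-*ˡ {zero}  c f = sym (ℤ.*-zeroʳ c)
sum-*ˡ {suc n} c f = trans (cong₂ _+_ (refl {x = c * f zero}) (sum-*ˡ c (f ∘ suc)))
                           (sym (ℤ.*-distribˡ-+ c (f zero) _))

I : ∀ {n} → Matrix n
I zero    zero    = + 1
I zero    (suc j) = + 0
I (suc i) zero    = + 0
I (suc i) (suc j) = I i j

I-diag : ∀ {n} (i : Fin n) → I i i ≡ + 1
I-diag zero    = refl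
I-diag (suc i) = I-diag i

I-off : ∀ {n} {i j : Fin n} → i ≢ j → I i j ≡ + 0
I-off {i = zero}  {zero}  i≢j = contradiction refl i≢j
I-off {i = zero}  {suc j} i≢j = refl
I-off {i = suc i} {zero}  i≢j = refl
I-off {i = suc i} {suc j} i≢j = I-off (i≢j ∘ cong suc)

I-sym : ∀ {n} (i j : Fin n) → I i j ≡ I j i
I-sym zero    zero    = refl
I-sym zero    (suc j) = refl
I-sym (suc i) zero    = refl
I-sym (suc i) (suc j) = I-sym i j

sum-I : ∀ {n} (f : Fin n → ℤ) i → sumFin (λ j → f j * I j i) ≡ f i
sum-I f zero    = trans
  (cong₂ _+_ (ℤ.*-identityʳ (f zero)) (sum-zero λ j → ℤ.*-zeroʳ (f (suc j))))
  (ℤ.+-identityʳ (f zero))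
sum-I f (suc i) = trans
  (cong₂ _+_ (ℤ.*-zeroʳ (f zero)) (sum-I (f ∘ suc) i))
  (ℤ.+-identityˡ (f (suc i)))

AgreeOff : ∀ {n m} → Fin n → (Fin n → Row m) → (Fin n → Row m) → Set
AgreeOff i M N = ∀ k → k ≢ i → ∀ l → M k l ≡ N k l

-- Linearity in a row is stated relationally, because row updates are not
-- judgementally well behaved without function extensionality.
record Alternating {n m} (F : (Fin n → Row m) → ℤ) : Set where
  field
    ext         : ∀ {M N} → (∀ i j → M i j ≡ N i j) → F M ≡ F N
    linear      : ∀ i c {L M N} → AgreeOff i L M → AgreeOff i L N →
                  (∀ l → L i l ≡ c * M i l + N i l) → F L ≡ c * F M + F N
    alternating : ∀ {i j M} → i ≢ j → (∀ l → M i l ≡ M j l) → F M ≡ + 0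

_[_↦_] : ∀ {n m} → (Fin n → Row m) → Fin n → Row m → Fin n → Row m
(M [ i ↦ v ]) k with k Fin.≟ i
... | yes _ = v
... | no  _ = M k

set-at : ∀ {n m} (M : Fin n → Row m) i v l → (M [ i ↦ v ]) i l ≡ v l
set-at M i v l with i Fin.≟ i
... | yes _   = refl
... | no  i≢i = contradiction refl i≢i

set-off : ∀ {n m} (M : Fin n → Row m) i v → AgreeOff i (M [ i ↦ v ]) M
set-off M i v k k≢i l with k Fin.≟ i
... | yes k≡i = contradiction k≡i k≢i
... | no  _   = refl

module _ {n m} {F : (Fin n → Row m) → ℤ} (alt : Alternating F) where
  open Alternating alt

  -- Put the sum u of the two rows in both places, where F vanishes. Expanding bilinearly gives four
  -- terms; the two with equal rows vanish, and F M + F N = 0 remains.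
  swap-rows : ∀ {i j M N} → i ≢ j → (∀ l → N i l ≡ M j l) → (∀ l → N j l ≡ M i l) →
              (∀ k → k ≢ i → k ≢ j → ∀ l → N k l ≡ M k l) → F N ≡ - F M
  swap-rows {i} {j} {M} {N} i≢j Ni Nj Nk =
    ring (F M) (F N) (trans (sym expanded) (alternating i≢j λ l → trans (W-i l) (sym (W-j l))))
    where
    W : Row m → Row m → Fin n → Row m
    W a b = (M [ i ↦ a ]) [ j ↦ b ]
    u : Row m
    u l = M i l + M j l
    W-i : ∀ {a b} l → W a b i l ≡ a l
    W-i {a} {b} l = trans (set-off (M [ i ↦ a ]) j b i i≢j l) (set-at M i a l)
    W-j : ∀ {a b} l → W a b j l ≡ b l
    W-j {a} {b} l = set-at (M [ i ↦ a ]) j b l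
    W-k : ∀ {a b} k → k ≢ i → k ≢ j → ∀ l → W a b k l ≡ M k l
    W-k {a} {b} k k≢i k≢j l = trans (set-off (M [ i ↦ a ]) j b k k≢j l) (set-off M i a k k≢i l)
    one* : ∀ x y → x + y ≡ + 1 * x + y
    one* = solve-∀
    off-i : ∀ a a′ b → AgreeOff i (W a b) (W a′ b)
    off-i a a′ b k k≢i l with k Fin.≟ j
    ... | yes _ = refl
    ... | no  _ = trans (set-off M i a k k≢i l) (sym (set-off M i a′ k k≢i l))
    off-j : ∀ a b b′ → AgreeOff j (W a b) (W a b′)
    off-j a b b′ k k≢j l =
      trans (set-off (M [ i ↦ a ]) j b k k≢j l) (sym (set-off (M [ i ↦ a ]) j b′ k k≢j l))
    linear-i : ∀ b → F (W u b) ≡ + 1 * F (W (M i) b) + F (W (M j) b)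
    linear-i b = linear i (+ 1) (off-i u (M i) b) (off-i u (M j) b)
      λ l → trans (W-i l) (trans (one* (M i l) (M j l)) (sym (cong₂ (λ x y → + 1 * x + y) (W-i l) (W-i l))))
    linear-j : ∀ a → F (W a u) ≡ + 1 * F (W a (M i)) + F (W a (M j))
    linear-j a = linear j (+ 1) (off-j a u (M i)) (off-j a u (M j))
      λ l → trans (W-j l) (trans (one* (M i l) (M j l)) (sym (cong₂ (λ x y → + 1 * x + y) (W-j l) (W-j l))))
    W-rows : ∀ {a b} {K : Fin n → Row m} → (∀ l → a l ≡ K i l) → (∀ l → b l ≡ K j l) →
             (∀ k → k ≢ i → k ≢ j → ∀ l → K k l ≡ M k l) → ∀ k l → W a b k l ≡ K k l
    W-rows Ki Kj Kk k l with k Fin.≟ i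
    ... | yes refl = trans (W-i l) (Ki l)
    ... | no k≢i with k Fin.≟ j
    ...   | yes refl = Kj l
    ...   | no k≢j = trans (set-off M i _ k k≢i l) (sym (Kk k k≢i k≢j l))
    expanded : F (W u u) ≡ + 1 * (+ 1 * + 0 + F M) + (+ 1 * F N + + 0)
    expanded = trans (linear-i u) (cong₂ (λ x y → + 1 * x + y)
      (trans (linear-j (M i)) (cong₂ (λ x y → + 1 * x + y)
        (alternating i≢j λ l → trans (W-i l) (sym (W-j l)))
        (ext (W-rows (λ _ → refl) (λ _ → refl) λ _ _ _ _ → refl))))
      (trans (linear-j (M j)) (cong₂ (λ x y → + 1 * x + y)
        (ext (W-rows (λ l → sym (Ni l)) (λ l → sym (Nj l)) Nk))
        (alternating i≢j λ l → trans (W-i l) (sym (W-j l))))))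
    ring : ∀ x y → + 1 * (+ 1 * + 0 + x) + (+ 1 * y + + 0) ≡ + 0 → y ≡ - x
    ring x y e = trans (r₁ x y) (trans (cong (_- x) e) (ℤ.+-identityˡ (- x)))
      where
      r₁ : ∀ x y → y ≡ + 1 * (+ 1 * + 0 + x) + (+ 1 * y + + 0) - x
      r₁ = solve-∀

-- The Laplace determinant is alternating

minor : ∀ {n} → Matrix (suc n) → Fin (suc n) → Matrix n
minor M j i k = M (suc i) (punchIn j k)

cons-off : ∀ {n m} (u v : Row m) (R : Fin n → Row m) → AgreeOff zero (u ∷ R) (v ∷ R)
cons-off u v R zero    k≢0 l = contradiction refl k≢0
cons-off u v R (suc k) k≢0 l = refl

off-suc : ∀ {n m} {M N : Fin (suc n) → Row m} {i} → AgreeOff (suc i) M N →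
          AgreeOff i (tail M) (tail N)
off-suc e k k≢i = e (suc k) (k≢i ∘ Fin.suc-injective)

-- (j , k) ↦ (punchIn j k , pinch k j) is the involution exchanging the two columns
-- deleted by a double expansion.
punchIn-pinch : ∀ {n} (j : Fin (suc n)) (k : Fin n) → punchIn (punchIn j k) (pinch k j) ≡ j
punchIn-pinch zero    zero    = refl
punchIn-pinch zero    (suc k) = refl
punchIn-pinch (suc j) zero    = refl
punchIn-pinch (suc j) (suc k) = cong suc (punchIn-pinch j k)

punchIn-comm : ∀ {n} (j : Fin (suc (suc n))) (k : Fin (suc n)) (l : Fin n) →
               punchIn j (punchIn k l) ≡ punchIn (punchIn j k) (punchIn (pinch k j) l)
punchIn-comm zero    zero    l       = refl
punchIn-comm zero    (suc k) l       = refl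
punchIn-comm (suc j) zero    l       = refl
punchIn-comm (suc j) (suc k) zero    = refl
punchIn-comm (suc j) (suc k) (suc l) = cong suc (punchIn-comm j k l)

-- Deleting the same two columns in the other order changes exactly one of the two indices, and
-- changes it by one.
sign-pinch : ∀ {n} (j : Fin (suc n)) (k : Fin n) →
             sign (toℕ j) * sign (toℕ k) ≡ - (sign (toℕ (punchIn j k)) * sign (toℕ (pinch k j)))
sign-pinch zero    zero    = refl
sign-pinch zero    (suc k) = ring (sign (toℕ k))
  where
  ring : ∀ x → + 1 * - x ≡ - (- - x * + 1)
  ring = solve-∀
sign-pinch (suc j) zero    = ring (sign (toℕ j))
  where
  ring : ∀ x → - x * + 1 ≡ - (+ 1 * x)
  ring = solve-∀
sign-pinch (suc j) (suc k) = ring (sign (toℕ j)) _ (sign (toℕ (punchIn j k))) _ (sign-pinch j k)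
  where
  neg-neg : ∀ x y → - x * - y ≡ x * y
  neg-neg = solve-∀
  ring : ∀ x y z w → x * y ≡ - (z * w) → - x * - y ≡ - (- z * - w)
  ring x y z w e = trans (neg-neg x y) (trans e (cong -_ (sym (neg-neg z w))))

-- The involution exchanges (0 , k) with (k + 1 , 0) and acts on the pairs (j + 1 , k + 1) as the
-- involution one size smaller. So the border cancels against itself and induction handles the rest.
sum-antisym : ∀ {n} (T : Fin (suc n) → Fin n → ℤ) →
              (∀ j k → T j k ≡ - T (punchIn j k) (pinch k j)) →
              sumFin (λ j → sumFin (T j)) ≡ + 0
sum-antisym {zero}  T anti = refl
sum-antisym {suc n} T anti = begin
  sumFin (T zero) + sumFin (λ j → T (suc j) zero + sumFin (λ k → T (suc j) (suc k)))
    ≡⟨ cong₂ _+_ (trans (sum-cong (anti zero)) (sum-cong λ k → sym (ℤ.-1*i≡-i (T (suc k) zero))))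
                 (sum-+ (λ j → T (suc j) zero) λ j → sumFin (λ k → T (suc j) (suc k))) ⟩
  sumFin (λ k → - + 1 * T (suc k) zero) +
    (sumFin (λ j → T (suc j) zero) + sumFin (λ j → sumFin (λ k → T (suc j) (suc k))))
    ≡⟨ cong₂ _+_ (sum-*ˡ (- + 1) λ k → T (suc k) zero)
         (cong₂ _+_ (refl {x = sumFin λ j → T (suc j) zero})
           (sum-antisym (λ j k → T (suc j) (suc k)) λ j k → anti (suc j) (suc k))) ⟩
  - + 1 * sumFin (λ k → T (suc k) zero) + (sumFin (λ j → T (suc j) zero) + + 0)
    ≡⟨ ring (sumFin λ k → T (suc k) zero) ⟩
  + 0 ∎
  where
  open ≡-Reasoning
  ring : ∀ x → - + 1 * x + (x + + 0) ≡ + 0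
  ring = solve-∀

laplace : ∀ {n} → Matrix (suc n) → Fin (suc n) → ℤ
laplace M j = sign (toℕ j) * (M zero j * det (minor M j))

det-cong : ∀ {n} {M N : Matrix n} → (∀ i j → M i j ≡ N i j) → det M ≡ det N
det-cong {zero}  e = refl
det-cong {suc n} e = sum-cong λ j → cong₂ (λ x y → sign (toℕ j) * (x * y)) (e zero j)
  (det-cong λ i k → e (suc i) (punchIn j k))

det-linear : ∀ {n} i c {L M N : Matrix n} → AgreeOff i L M → AgreeOff i L N →
             (∀ l → L i l ≡ c * M i l + N i l) → det L ≡ c * det M + det N
det-linear {suc n} zero c {L} {M} {N} LM LN e = trans (sum-cong term) (sum-linear c (laplace M) (laplace N))
  where
  ring : ∀ s c x y d → s * ((c * x + y) * d) ≡ c * (s * (x * d)) + s * (y * d)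
  ring = solve-∀
  term : ∀ j → laplace L j ≡ c * laplace M j + laplace N j
  term j rewrite e j | sym (det-cong {M = minor L j} λ i k → LM (suc i) (λ ()) (punchIn j k))
    | sym (det-cong {M = minor L j} λ i k → LN (suc i) (λ ()) (punchIn j k))
    = ring (sign (toℕ j)) c (M zero j) (N zero j) (det (minor L j))
det-linear {suc n} (suc i) c {L} {M} {N} LM LN e = trans (sum-cong term) (sum-linear c (laplace M) (laplace N))
  where
  ring : ∀ s c x d d′ → s * (x * (c * d + d′)) ≡ c * (s * (x * d)) + s * (x * d′)
  ring = solve-∀
  term : ∀ j → laplace L j ≡ c * laplace M j + laplace N j
  term j rewrite sym (LM zero (λ ()) j) | sym (LN zero (λ ()) j)
    | det-linear i c {minor L j} {minor M j} {minor N j}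
        (λ k k≢i l → off-suc {M = L} {M} LM k k≢i (punchIn j l))
        (λ k k≢i l → off-suc {M = L} {N} LN k k≢i (punchIn j l)) (λ l → e (punchIn j l))
    = ring (sign (toℕ j)) c (L zero j) (det (minor M j)) (det (minor N j))

-- In the double expansion along two equal rows, deleting columns in either order leaves the same
-- minor `E` and the same product of entries, but opposite signs.
det-equal₀₁ : ∀ {n} (M : Matrix (suc (suc n))) → (∀ l → M zero l ≡ M (suc zero) l) → det M ≡ + 0
det-equal₀₁ {n} M e = trans (sum-cong expand) (sum-antisym T anti)
  where
  E : Fin (suc (suc n)) → Fin (suc n) → Matrix n
  E j k i l = M (suc (suc i)) (punchIn j (punchIn k l))
  T : Fin (suc (suc n)) → Fin (suc n) → ℤ
  T j k = (sign (toℕ j) * sign (toℕ k)) * ((M zero j * M zero (punchIn j k)) * det (E j k))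
  ring : ∀ s t x y d → s * x * (t * (y * d)) ≡ s * t * (x * y * d)
  ring = solve-∀
  expand : ∀ j → laplace M j ≡ sumFin (T j)
  expand j = begin
    sign (toℕ j) * (M zero j * det (minor M j))  ≡⟨ ℤ.*-assoc (sign (toℕ j)) (M zero j) _ ⟨
    sign (toℕ j) * M zero j * det (minor M j)    ≡⟨ sum-*ˡ (sign (toℕ j) * M zero j) (laplace (minor M j)) ⟨
    sumFin (λ k → sign (toℕ j) * M zero j *
      (sign (toℕ k) * (M (suc zero) (punchIn j k) * det (E j k))))
      ≡⟨ sum-cong (λ k → trans (ring (sign (toℕ j)) (sign (toℕ k)) (M zero j)
             (M (suc zero) (punchIn j k)) (det (E j k)))
           (cong (λ x → sign (toℕ j) * sign (toℕ k) * (M zero j * x * det (E j k)))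
             (sym (e (punchIn j k))))) ⟩
    sumFin (T j) ∎
    where open ≡-Reasoning
  anti : ∀ j k → T j k ≡ - T (punchIn j k) (pinch k j)
  anti j k = begin
    T j k
      ≡⟨ cong₂ _*_ (sign-pinch j k) (cong₂ _*_ (ℤ.*-comm (M zero j) _)
           (det-cong λ i l → cong (M (suc (suc i))) (punchIn-comm j k l))) ⟩
    - (sign (toℕ (punchIn j k)) * sign (toℕ (pinch k j))) *
      ((M zero (punchIn j k) * M zero j) * det (E (punchIn j k) (pinch k j)))
      ≡⟨ ℤ.neg-distribˡ-* (sign (toℕ (punchIn j k)) * sign (toℕ (pinch k j))) _ ⟨
    - (sign (toℕ (punchIn j k)) * sign (toℕ (pinch k j)) *
      ((M zero (punchIn j k) * M zero j) * det (E (punchIn j k) (pinch k j))))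
      ≡⟨ cong (λ x → - (sign (toℕ (punchIn j k)) * sign (toℕ (pinch k j)) *
           ((M zero (punchIn j k) * M zero x) * det (E (punchIn j k) (pinch k j)))))
           (punchIn-pinch j k) ⟨
    - T (punchIn j k) (pinch k j) ∎
    where open ≡-Reasoning

det-row₀-zero : ∀ {n} (M : Matrix (suc n)) → (∀ j → det (minor M j) ≡ + 0) → det M ≡ + 0
det-row₀-zero M e = sum-zero λ j →
  trans (cong (λ x → sign (toℕ j) * (M zero j * x)) (e j)) (ring (sign (toℕ j)) (M zero j))
  where
  ring : ∀ s x → s * (x * + 0) ≡ + 0
  ring = solve-∀

-- Below row 0 the minors are alternating by induction, so the equal row may be swapped into
-- position 1 at the cost of a sign; this reduces to `det-equal₀₁`.
det-equal₀ : ∀ {n} → Alternating (det {n}) → (M : Matrix (suc n)) →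
             ∀ j → (∀ l → M zero l ≡ M (suc j) l) → det M ≡ + 0
det-equal₀ {suc n} alt M zero    e = det-equal₀₁ M e
det-equal₀ {suc n} alt M (suc j) e = begin
  det M      ≡⟨ ℤ.neg-involutive (det M) ⟨
  - - det M  ≡⟨ cong -_ swapped ⟨
  - det N    ≡⟨ cong -_ (det-equal₀₁ N e) ⟩
  + 0        ∎
  where
  open ≡-Reasoning
  N : Matrix (suc (suc n))
  N zero          = M zero
  N (suc zero)    = M (suc (suc j))
  N (suc (suc i)) = (tail (tail M) [ j ↦ M (suc zero) ]) i
  minor-swap : ∀ c → det (minor N c) ≡ - det (minor M c)
  minor-swap c = swap-rows alt {zero} {suc j} {minor M c} {minor N c} (λ ()) (λ _ → refl)
    (λ l → set-at (tail (tail M)) j _ (punchIn c l)) λ where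
      zero    0≢0 _   l → contradiction refl 0≢0
      (suc k) _   k≢j l → set-off (tail (tail M)) j _ k (k≢j ∘ cong suc) (punchIn c l)
  ring : ∀ s x d → s * (x * - d) ≡ - + 1 * (s * (x * d))
  ring = solve-∀
  swapped : det N ≡ - det M
  swapped = trans (sum-cong λ c →
      trans (cong (λ x → sign (toℕ c) * (M zero c * x)) (minor-swap c))
            (ring (sign (toℕ c)) (M zero c) (det (minor M c))))
    (trans (sum-*ˡ (- + 1) (laplace M))
      (ℤ.-1*i≡-i (det M)))

det-equal : ∀ {n} → Alternating (det {n}) → ∀ {i j} {M : Matrix (suc n)} → i ≢ j →
            (∀ l → M i l ≡ M j l) → det M ≡ + 0
det-equal alt {zero}  {zero}      i≢j e = contradiction refl i≢j
det-equal alt {zero}  {suc j} {M} i≢j e = det-equal₀ alt M j e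
det-equal alt {suc i} {zero}  {M} i≢j e = det-equal₀ alt M i (λ l → sym (e l))
det-equal alt {suc i} {suc j} {M} i≢j e = det-row₀-zero M λ c →
  Alternating.alternating alt {i} {j} {minor M c} (i≢j ∘ cong suc) (λ l → e (punchIn c l))

det-alternating : ∀ n → Alternating (det {n})
det-alternating zero    = record
  { ext = det-cong ; linear = λ () ; alternating = λ { {()} } }
det-alternating (suc n) = record
  { ext = det-cong ; linear = det-linear ; alternating = det-equal (det-alternating n) }

det-I : ∀ n → det (I {n}) ≡ + 1
det-I zero    = refl
det-I (suc n) = trans
  (cong₂ _+_ (ring (det (I {n}))) (sum-zero {f = λ j → laplace (I {suc n}) (suc j)}
    λ j → ring₀ (sign (toℕ (suc j))) (det (minor (I {suc n}) (suc j)))))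
  (trans (ℤ.+-identityʳ (det (I {n}))) (det-I n))
  where
  ring : ∀ d → + 1 * (+ 1 * d) ≡ d
  ring = solve-∀
  ring₀ : ∀ s d → s * (+ 0 * d) ≡ + 0
  ring₀ = solve-∀

-- Uniqueness of alternating forms and the product rule

punchIn-cover : ∀ {n} {P : Fin (suc n) → Set} j → P j → (∀ k → P (punchIn j k)) → ∀ l → P l
punchIn-cover {P = P} j Pj Pk l with j Fin.≟ l
... | yes refl = Pj
... | no  j≢l  = subst P (Fin.punchIn-punchOut j≢l) (Pk (punchOut j≢l))

insertAt-at : ∀ {n} (v : Row n) j x → insertAt v j x j ≡ x
insertAt-at         v zero    x = refl
insertAt-at {suc n} v (suc j) x = insertAt-at (tail v) j x

insertAt-punchIn : ∀ {n} (v : Row n) j x k → insertAt v j x (punchIn j k) ≡ v k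
insertAt-punchIn v zero    x k       = refl
insertAt-punchIn v (suc j) x zero    = refl
insertAt-punchIn v (suc j) x (suc k) = insertAt-punchIn (tail v) j x k

-- Rows are exchanged one at a time. The hypothesis `step` leaves the rows other than i arbitrary,
-- because when row i is replaced the earlier ones already come from R′.
change-rows : ∀ {n m} (Φ : (Fin n → Row m) → ℤ) → (∀ {S T} → (∀ i l → S i l ≡ T i l) → Φ S ≡ Φ T) →
  (R R′ : Fin n → Row m) →
  (∀ i S S′ → AgreeOff i S S′ → (∀ l → S i l ≡ R i l) → (∀ l → S′ i l ≡ R′ i l) → Φ S ≡ Φ S′) →
  Φ R ≡ Φ R′
change-rows {zero}  Φ ext R R′ step = ext λ ()
change-rows {suc n} Φ ext R R′ step = trans
  (step zero R (R′ zero ∷ tail R) off (λ _ → refl) (λ _ → refl))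
  (trans (change-rows (λ S → Φ (R′ zero ∷ S)) (λ e → ext (cons e)) (tail R) (tail R′) step′)
         (ext λ { zero l → refl ; (suc i) l → refl }))
  where
  off : AgreeOff zero R (R′ zero ∷ tail R)
  off zero    0≢0 l = contradiction refl 0≢0
  off (suc k) _   l = refl
  cons : ∀ {S T : Fin n → Row _} → (∀ i l → S i l ≡ T i l) →
         ∀ i l → (R′ zero ∷ S) i l ≡ (R′ zero ∷ T) i l
  cons e zero    l = refl
  cons e (suc i) l = e i l
  step′ : ∀ i S S′ → AgreeOff i S S′ → (∀ l → S i l ≡ R (suc i) l) →
          (∀ l → S′ i l ≡ R′ (suc i) l) → Φ (R′ zero ∷ S) ≡ Φ (R′ zero ∷ S′)
  step′ i S S′ e = step (suc i) (R′ zero ∷ S) (R′ zero ∷ S′) λ where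
    zero    _   l → refl
    (suc k) k≢i l → e k (k≢i ∘ cong suc) l

module _ {n m} {F : (Fin (suc n) → Row m) → ℤ} (alt : Alternating F) where
  open Alternating alt

  linear-sum : ∀ {p} (c : Fin p → ℤ) (v : Fin p → Row m) R →
               F ((λ l → sumFin λ j → c j * v j l) ∷ R) ≡ sumFin (λ j → c j * F (v j ∷ R))
  linear-sum {zero}  c v R = trans
    -- The zero row is -1 times itself plus itself, so its value x satisfies x = -x + x = 0.
    (linear zero (- + 1) {_} {_} {(λ l → + 0) ∷ R} (λ _ _ _ → refl) (λ _ _ _ → refl) (λ _ → refl))
    (ring (F ((λ l → + 0) ∷ R)))
    where
    ring : ∀ x → - + 1 * x + x ≡ + 0
    ring = solve-∀
  linear-sum {suc p} c v R = trans
    (linear zero (c zero) (cons-off _ _ R) (cons-off _ _ R) (λ _ → refl))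
    (cong₂ _+_ (refl {x = c zero * F (v zero ∷ R)}) (linear-sum (c ∘ suc) (v ∘ suc) R))

clear : ∀ {n m} → Fin (suc m) → (Fin n → Row (suc m)) → Fin n → Row (suc m)
clear j R i = insertAt (removeAt (R i) j) j (+ 0)

module _ {n} {F : Matrix (suc n) → ℤ} (alt : Alternating F) where
  open Alternating alt

  expand-row₀ : ∀ M → F M ≡ sumFin (λ j → M zero j * F (I j ∷ tail M))
  expand-row₀ M = trans
    (ext λ { zero l → sym (sum-I (M zero) l) ; (suc i) l → refl })
    (linear-sum alt (M zero) I (tail M))

  -- Subtracting `R i j` times the top row `I j` from row i clears its entry in column j and leaves
  -- the value of an alternating form unchanged.
  clear-column : ∀ j R → F (I j ∷ R) ≡ F (I j ∷ clear j R)
  clear-column j R = change-rows (λ S → F (I j ∷ S))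
    (λ e → ext λ { zero l → refl ; (suc i) l → e i l }) R (clear j R) step
    where
    ring₀ : ∀ x → + 0 ≡ - x * + 1 + x
    ring₀ = solve-∀
    ring₁ : ∀ x y → y ≡ - x * + 0 + y
    ring₁ = solve-∀
    ring₂ : ∀ c x → - c * + 0 + x ≡ x
    ring₂ = solve-∀
    off : ∀ {i} {S T : Fin n → Row (suc n)} → AgreeOff i S T →
          AgreeOff (suc i) (I j ∷ S) (I j ∷ T)
    off e zero    _   l = refl
    off e (suc k) k≢i l = e k (k≢i ∘ cong suc) l
    cleared : ∀ i l → clear j R i l ≡ - R i j * I j l + R i l
    cleared i = punchIn-cover j
      (trans (insertAt-at (removeAt (R i) j) j (+ 0))
        (trans (ring₀ (R i j)) (cong (λ x → - R i j * x + R i j) (sym (I-diag j)))))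
      (λ k → trans (insertAt-punchIn (removeAt (R i) j) j (+ 0) k)
        (trans (ring₁ (R i j) (R i (punchIn j k)))
          (cong (λ x → - R i j * x + R i (punchIn j k))
            (sym (I-off (λ e → Fin.punchInᵢ≢i j k (sym e)))))))
    step : ∀ i S S′ → AgreeOff i S S′ → (∀ l → S i l ≡ R i l) →
           (∀ l → S′ i l ≡ clear j R i l) → F (I j ∷ S) ≡ F (I j ∷ S′)
    step i S S′ SS′ Si S′i = sym (begin
      F (I j ∷ S′)
        ≡⟨ linear (suc i) (- R i j) {I j ∷ S′} {I j ∷ S″} {I j ∷ S}
             (off λ k k≢i l → trans (sym (SS′ k k≢i l)) (sym (set-off S i (I j) k k≢i l)))
             (off λ k k≢i l → sym (SS′ k k≢i l))
             (λ l → trans (S′i l) (trans (cleared i l)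
               (sym (cong₂ (λ x y → - R i j * x + y) (set-at S i (I j) l) (Si l))))) ⟩
      - R i j * F (I j ∷ S″) + F (I j ∷ S)
        ≡⟨ cong (λ x → - R i j * x + F (I j ∷ S))
             (alternating {zero} {suc i} (λ ()) λ l → sym (set-at S i (I j) l)) ⟩
      - R i j * + 0 + F (I j ∷ S)  ≡⟨ ring₂ (R i j) (F (I j ∷ S)) ⟩
      F (I j ∷ S)                  ∎)
      where
      open ≡-Reasoning
      S″ : Fin n → Row (suc n)
      S″ = S [ i ↦ I j ]

  insert-alternating : ∀ j → Alternating (λ R → F (I j ∷ λ i → insertAt (R i) j (+ 0)))
  insert-alternating j = record
    { ext         = λ e → ext λ where
        zero    l → refl
        (suc i) l → insert-cong {j = j} (e i) l
    ; linear      = λ i c {L} {M} {N} LM LN e → linear (suc i) c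
        (off LM) (off LN) (insert-linear c (L i) (M i) (N i) e)
    ; alternating = λ {i} {i′} i≢i′ e →
        alternating {suc i} {suc i′} (i≢i′ ∘ Fin.suc-injective) (insert-cong {j = j} e)
    }
    where
    insert-cong : ∀ {m j} {u v : Row m} → (∀ l → u l ≡ v l) →
                  ∀ l → insertAt u j (+ 0) l ≡ insertAt v j (+ 0) l
    insert-cong {j = j} {u} {v} e = punchIn-cover j
      (trans (insertAt-at u j (+ 0)) (sym (insertAt-at v j (+ 0))))
      (λ k → trans (insertAt-punchIn u j (+ 0) k) (trans (e k) (sym (insertAt-punchIn v j (+ 0) k))))
    ring₀ : ∀ c → + 0 ≡ c * + 0 + + 0
    ring₀ = solve-∀
    insert-linear : ∀ c (L M N : Row n) → (∀ l → L l ≡ c * M l + N l) →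
      ∀ l → insertAt L j (+ 0) l ≡ c * insertAt M j (+ 0) l + insertAt N j (+ 0) l
    insert-linear c L M N e = punchIn-cover j
      (trans (insertAt-at L j (+ 0)) (trans (ring₀ c)
        (sym (cong₂ (λ x y → c * x + y) (insertAt-at M j (+ 0)) (insertAt-at N j (+ 0))))))
      (λ k → trans (insertAt-punchIn L j (+ 0) k) (trans (e k)
        (sym (cong₂ (λ x y → c * x + y)
          (insertAt-punchIn M j (+ 0) k) (insertAt-punchIn N j (+ 0) k)))))
    off : ∀ {i} {S T : Fin n → Row n} → AgreeOff i S T →
          AgreeOff (suc i) (I j ∷ λ i → insertAt (S i) j (+ 0)) (I j ∷ λ i → insertAt (T i) j (+ 0))
    off e zero    _   l = refl
    off e (suc k) k≢i l = insert-cong {j = j} (e k (k≢i ∘ cong suc)) l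

punchIn-suc-diag : ∀ {n} (j : Fin n) → punchIn (suc j) j ≡ inject₁ j
punchIn-suc-diag zero    = refl
punchIn-suc-diag (suc j) = cong suc (punchIn-suc-diag j)

punchIn-inject₁-diag : ∀ {n} (j : Fin n) → punchIn (inject₁ j) j ≡ suc j
punchIn-inject₁-diag zero    = refl
punchIn-inject₁-diag (suc j) = cong suc (punchIn-inject₁-diag j)

punchIn-suc-off : ∀ {n} (j k : Fin n) → k ≢ j → punchIn (suc j) k ≡ punchIn (inject₁ j) k
punchIn-suc-off zero    zero    0≢0 = contradiction refl 0≢0
punchIn-suc-off zero    (suc k) _   = refl
punchIn-suc-off (suc j) zero    _   = refl
punchIn-suc-off (suc j) (suc k) k≢j = cong suc (punchIn-suc-off j k (k≢j ∘ cong suc))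

-- The identity with row j moved to the top: the matrix that arises when the cleared minor in
-- `alternating-unique` is the identity.
cycle : ∀ {n} → Fin (suc n) → Matrix (suc n)
cycle j zero    = I j
cycle j (suc k) = I (punchIn j k)

-- Row j reaches the top after j transpositions, each with the current top row. The separate m
-- carries the recursion, since `inject₁ j` is not a subterm of `suc j`.
alternating-cycle : ∀ {n} {F : Matrix (suc n) → ℤ} → Alternating F →
                    ∀ m j → toℕ j ≡ m → F (cycle j) ≡ sign m * F I
alternating-cycle {F = F} alt zero zero refl =
  trans (Alternating.ext alt λ { zero l → refl ; (suc i) l → refl }) (sym (ℤ.*-identityˡ (F I)))
alternating-cycle {suc n} {F} alt (suc m) (suc j) refl = begin
  F (cycle (suc j))       ≡⟨ swap-rows alt {zero} {suc j} {cycle (inject₁ j)} (λ ())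
                               (λ l → cong (λ x → I x l) (sym (punchIn-inject₁-diag j)))
                               (λ l → cong (λ x → I x l) (punchIn-suc-diag j))
                               (λ where
                                 zero    0≢0 _   l → contradiction refl 0≢0
                                 (suc k) _   k≢j l → cong (λ x → I x l)
                                   (punchIn-suc-off j k (k≢j ∘ cong suc))) ⟩
  - F (cycle (inject₁ j)) ≡⟨ cong -_ (alternating-cycle alt m (inject₁ j) (Fin.toℕ-inject₁ j)) ⟩
  - (sign m * F I)        ≡⟨ ℤ.neg-distribˡ-* (sign m) (F I) ⟩
  - sign m * F I          ∎
  where open ≡-Reasoning

-- Expand row 0 over the basis rows. Under the top row `I j`, column j can be cleared, which leaves
-- an alternating form in the minor. By induction that form is its value at the identity,
-- `sign (toℕ j) * F I`, times the determinant of the minor, so the sum is the Laplace expansion.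
alternating-unique : ∀ {n} {F : Matrix n → ℤ} → Alternating F → ∀ M → F M ≡ F I * det M
alternating-unique {zero}  {F} alt M = trans (Alternating.ext alt λ ()) (sym (ℤ.*-identityʳ (F I)))
alternating-unique {suc n} {F} alt M = begin
  F M                                             ≡⟨ expand-row₀ alt M ⟩
  sumFin (λ j → M zero j * F (I j ∷ tail M))      ≡⟨ sum-cong term ⟩
  sumFin (λ j → F I * laplace M j)                ≡⟨ sum-*ˡ (F I) (laplace M) ⟩
  F I * det M                                     ∎
  where
  open ≡-Reasoning
  ring : ∀ x s f d → x * (s * f * d) ≡ f * (s * (x * d))
  ring = solve-∀
  insert-I : ∀ j k l → insertAt (I k) j (+ 0) l ≡ I (punchIn j k) l
  insert-I j k = punchIn-cover j
    (trans (insertAt-at (I k) j (+ 0)) (sym (I-off (Fin.punchInᵢ≢i j k))))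
    (λ k′ → trans (insertAt-punchIn (I k) j (+ 0) k′) (I-punchIn j k k′))
    where
    I-punchIn : ∀ {n} j (k k′ : Fin n) → I k k′ ≡ I (punchIn j k) (punchIn j k′)
    I-punchIn zero    k       k′       = refl
    I-punchIn (suc j) zero    zero     = refl
    I-punchIn (suc j) zero    (suc k′) = refl
    I-punchIn (suc j) (suc k) zero     = refl
    I-punchIn (suc j) (suc k) (suc k′) = I-punchIn j k k′
  term : ∀ j → M zero j * F (I j ∷ tail M) ≡ F I * laplace M j
  term j = begin
    M zero j * F (I j ∷ tail M)
      ≡⟨ cong (M zero j *_) (clear-column alt j (tail M)) ⟩
    M zero j * F (I j ∷ clear j (tail M))
      ≡⟨ cong (M zero j *_) (alternating-unique (insert-alternating alt j) (minor M j)) ⟩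
    M zero j * (F (I j ∷ λ i → insertAt (I i) j (+ 0)) * det (minor M j))
      ≡⟨ cong (λ x → M zero j * (x * det (minor M j))) (trans
           (Alternating.ext alt λ { zero l → refl ; (suc i) l → insert-I j i l })
           (alternating-cycle alt (toℕ j) j refl)) ⟩
    M zero j * (sign (toℕ j) * F I * det (minor M j))
      ≡⟨ ring (M zero j) (sign (toℕ j)) (F I) (det (minor M j)) ⟩
    F I * laplace M j ∎

infixl 7 _⊗_
_⊗_ : ∀ {n} → Matrix n → Matrix n → Matrix n
(M ⊗ N) i j = sumFin λ k → M i k * N k j

-- For fixed N the left side is an alternating form in the rows of M, with value `det N` at the
-- identity.
det-⊗ : ∀ {n} (M N : Matrix n) → det (M ⊗ N) ≡ det M * det N
det-⊗ {n} M N = begin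
  det (M ⊗ N)          ≡⟨ alternating-unique alt M ⟩
  det (I ⊗ N) * det M  ≡⟨ cong (_* det M) (det-cong λ i j → I⊗ i j) ⟩
  det N * det M        ≡⟨ ℤ.*-comm (det N) (det M) ⟩
  det M * det N        ∎
  where
  open ≡-Reasoning
  I⊗ : ∀ i j → (I ⊗ N) i j ≡ N i j
  I⊗ i j = trans (sum-cong λ k → trans (ℤ.*-comm (I i k) (N k j)) (cong (N k j *_) (I-sym i k)))
                 (sum-I (λ k → N k j) i)
  row : ∀ (u v : Row n) → (∀ l → u l ≡ v l) → ∀ j → sumFin (λ k → u k * N k j) ≡ sumFin (λ k → v k * N k j)
  row u v e j = sum-cong λ k → cong (_* N k j) (e k)
  ring : ∀ c x y z → (c * x + y) * z ≡ c * (x * z) + y * z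
  ring = solve-∀
  alt : Alternating (λ M → det (M ⊗ N))
  alt = record
    { ext         = λ e → det-cong λ i j → row _ _ (e i) j
    ; linear      = λ i c {L} {M} {K} LM LK e → det-linear i c
        (λ k k≢i → row (L k) (M k) (LM k k≢i)) (λ k k≢i → row (L k) (K k) (LK k k≢i))
        (λ l → trans (sum-cong λ k → trans (cong (_* N k l) (e k)) (ring c (M i k) (K i k) (N k l)))
          (sum-linear c (λ k → M i k * N k l) (λ k → K i k * N k l)))
    ; alternating = λ {i} {j} {M} i≢j e → Alternating.alternating (det-alternating n) i≢j
        (row (M i) (M j) e)
    }

-- Block-diagonal determinants

module Block {N n m} (e : Fin N ↔ (Fin n ⊎ Fin m)) where
  open Inverse e

  entry : Matrix n → Matrix m → Fin n ⊎ Fin m → Fin n ⊎ Fin m → ℤ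
  entry A B (inj₁ i) (inj₁ j) = A i j
  entry A B (inj₁ i) (inj₂ j) = + 0
  entry A B (inj₂ i) (inj₁ j) = + 0
  entry A B (inj₂ i) (inj₂ j) = B i j

  -- The blocks sit on two arbitrary classes of indices, later the even and the odd ones. Rows and
  -- columns are split by the same bijection, so no sign of a permutation has to be computed.
  block : Matrix n → Matrix m → Matrix N
  block A B i j = entry A B (to i) (to j)

  to-injective : ∀ {i j} → to i ≡ to j → i ≡ j
  to-injective {i} {j} eq = trans (sym (strictlyInverseʳ i)) (trans (cong from eq) (strictlyInverseʳ j))

  entry-cong : ∀ {A A′ B B′} → (∀ i j → A i j ≡ A′ i j) → (∀ i j → B i j ≡ B′ i j) →
               ∀ x y → entry A B x y ≡ entry A′ B′ x y
  entry-cong a b (inj₁ i) (inj₁ j) = a i j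
  entry-cong a b (inj₁ i) (inj₂ j) = refl
  entry-cong a b (inj₂ i) (inj₁ j) = refl
  entry-cong a b (inj₂ i) (inj₂ j) = b i j

  ring₀ : ∀ c → + 0 ≡ c * + 0 + + 0
  ring₀ = solve-∀

  left-alternating : ∀ B → Alternating (λ A → det (block A B))
  left-alternating B = record
    { ext         = λ a → det-cong λ i j → entry-cong a (λ _ _ → refl) (to i) (to j)
    ; linear      = λ i c {L} {M} {K} LM LK a → det-linear (from (inj₁ i)) c
        (λ k k≢ l → off LM (to k) (to l) λ eq → k≢ (to-injective (trans eq (sym (strictlyInverseˡ _)))))
        (λ k k≢ l → off LK (to k) (to l) λ eq → k≢ (to-injective (trans eq (sym (strictlyInverseˡ _)))))
        (λ l → at i c a (to (from (inj₁ i))) (to l) (strictlyInverseˡ _))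
    ; alternating = λ {i} {j} i≢j a → Alternating.alternating (det-alternating N)
        {from (inj₁ i)} {from (inj₁ j)}
        (λ eq → i≢j (inj₁-injective
          (trans (sym (strictlyInverseˡ _)) (trans (cong to eq) (strictlyInverseˡ _)))))
        (λ l → equal a (strictlyInverseˡ _) (strictlyInverseˡ _) (to l))
    }
    where
    off : ∀ {i L M} → AgreeOff i L M → ∀ x y → x ≢ inj₁ i → entry L B x y ≡ entry M B x y
    off LM (inj₁ k) (inj₁ l) ne = LM k (ne ∘ cong inj₁) l
    off LM (inj₁ k) (inj₂ l) ne = refl
    off LM (inj₂ k) (inj₁ l) ne = refl
    off LM (inj₂ k) (inj₂ l) ne = refl
    at : ∀ i c {L M K} → (∀ l → L i l ≡ c * M i l + K i l) → ∀ x y → x ≡ inj₁ i →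
         entry L B x y ≡ c * entry M B x y + entry K B x y
    at i c a _ (inj₁ l) refl = a l
    at i c a _ (inj₂ l) refl = ring₀ c
    equal : ∀ {i j M x y} → (∀ l → M i l ≡ M j l) → x ≡ inj₁ i → y ≡ inj₁ j →
            ∀ z → entry M B x z ≡ entry M B y z
    equal a refl refl (inj₁ l) = a l
    equal a refl refl (inj₂ l) = refl

  right-alternating : ∀ A → Alternating (λ B → det (block A B))
  right-alternating A = record
    { ext         = λ b → det-cong λ i j → entry-cong (λ _ _ → refl) b (to i) (to j)
    ; linear      = λ i c {L} {M} {K} LM LK b → det-linear (from (inj₂ i)) c
        (λ k k≢ l → off LM (to k) (to l) λ eq → k≢ (to-injective (trans eq (sym (strictlyInverseˡ _)))))
        (λ k k≢ l → off LK (to k) (to l) λ eq → k≢ (to-injective (trans eq (sym (strictlyInverseˡ _)))))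
        (λ l → at i c b (to (from (inj₂ i))) (to l) (strictlyInverseˡ _))
    ; alternating = λ {i} {j} i≢j b → Alternating.alternating (det-alternating N)
        {from (inj₂ i)} {from (inj₂ j)}
        (λ eq → i≢j (inj₂-injective
          (trans (sym (strictlyInverseˡ _)) (trans (cong to eq) (strictlyInverseˡ _)))))
        (λ l → equal b (strictlyInverseˡ _) (strictlyInverseˡ _) (to l))
    }
    where
    off : ∀ {i L M} → AgreeOff i L M → ∀ x y → x ≢ inj₂ i → entry A L x y ≡ entry A M x y
    off LM (inj₂ k) (inj₂ l) ne = LM k (ne ∘ cong inj₂) l
    off LM (inj₁ k) (inj₂ l) ne = refl
    off LM (inj₂ k) (inj₁ l) ne = refl
    off LM (inj₁ k) (inj₁ l) ne = refl
    at : ∀ i c {L M K} → (∀ l → L i l ≡ c * M i l + K i l) → ∀ x y → x ≡ inj₂ i →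
         entry A L x y ≡ c * entry A M x y + entry A K x y
    at i c a _ (inj₂ l) refl = a l
    at i c a _ (inj₁ l) refl = ring₀ c
    equal : ∀ {i j M x y} → (∀ l → M i l ≡ M j l) → x ≡ inj₂ i → y ≡ inj₂ j →
            ∀ z → entry A M x z ≡ entry A M y z
    equal a refl refl (inj₂ l) = a l
    equal a refl refl (inj₁ l) = refl

  entry-I : ∀ x y → entry I I x y ≡ I (from x) (from y)
  entry-I x y with from x Fin.≟ from y
  ... | yes eq with refl ← trans (sym (strictlyInverseˡ x)) (trans (cong to eq) (strictlyInverseˡ y)) =
        trans (diag x) (sym (I-diag (from x)))
    where
    diag : ∀ x → entry I I x x ≡ + 1
    diag (inj₁ i) = I-diag i
    diag (inj₂ i) = I-diag i
  ... | no ne = trans (off x y (ne ∘ cong from)) (sym (I-off ne))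
    where
    off : ∀ x y → x ≢ y → entry I I x y ≡ + 0
    off (inj₁ i) (inj₁ j) ne = I-off (ne ∘ cong inj₁)
    off (inj₁ i) (inj₂ j) ne = refl
    off (inj₂ i) (inj₁ j) ne = refl
    off (inj₂ i) (inj₂ j) ne = I-off (ne ∘ cong inj₂)

  -- Uniqueness is applied to A for fixed B, then to B with A replaced by the identity.
  det-block : ∀ A B → det (block A B) ≡ det A * det B
  det-block A B = begin
    det (block A B)                  ≡⟨ alternating-unique (left-alternating B) A ⟩
    det (block I B) * det A          ≡⟨ cong (_* det A) (alternating-unique (right-alternating I) B) ⟩
    det (block I I) * det B * det A  ≡⟨ cong (λ x → x * det B * det A) (trans (det-cong λ i j →
                                          trans (entry-I (to i) (to j))
                                            (cong₂ I (strictlyInverseʳ i) (strictlyInverseʳ j)))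
                                          (det-I N)) ⟩
    + 1 * det B * det A              ≡⟨ ring (det A) (det B) ⟩
    det A * det B                    ∎
    where
    open ≡-Reasoning
    ring : ∀ a b → + 1 * b * a ≡ a * b
    ring = solve-∀

-- Circulant determinants

-- Circulants are described by periodic functions on ℤ, so that arithmetic on indices is ring
-- arithmetic without reduction modulo n.
Periodic : ℕ → (ℤ → ℤ) → Set
Periodic n f = ∀ x → f (x + + n) ≡ f x

sum< : ∀ n → (ℤ → ℤ) → ℤ
sum< n f = sumFin {n} λ k → f (+ toℕ k)

sum-snoc : ∀ n (f : ℕ → ℤ) →
           f 0 + sumFin {n} (λ k → f (suc (toℕ k))) ≡ sumFin {n} (λ k → f (toℕ k)) + f n
sum-snoc zero    f = ℤ.+-comm (f 0) (+ 0)
sum-snoc (suc n) f = trans (cong₂ _+_ (refl {x = f 0}) (sum-snoc n (f ∘ suc)))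
  (sym (ℤ.+-assoc (f 0) (sumFin {n} λ k → f (suc (toℕ k))) (f (suc n))))

sum-shift₁ : ∀ n f → Periodic n f → sum< n (λ x → f (x + + 1)) ≡ sum< n f
sum-shift₁ n f per = begin
  sum< n (λ x → f (x + + 1))        ≡⟨ sum-cong (λ (k : Fin n) → cong (f ∘ +_) (ℕ.+-comm (toℕ k) 1)) ⟩
  sumFin {n} (λ k → f (+ suc (toℕ k)))  ≡⟨ ring (f (+ 0)) _ ⟩
  f (+ 0) + sumFin {n} (λ k → f (+ suc (toℕ k))) - f (+ 0)
    ≡⟨ cong (_- f (+ 0)) (sum-snoc n (f ∘ +_)) ⟩
  sum< n f + f (+ n) - f (+ 0)      ≡⟨ cong (λ x → sum< n f + x - f (+ 0)) (per (+ 0)) ⟩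
  sum< n f + f (+ 0) - f (+ 0)      ≡⟨ ring′ (f (+ 0)) (sum< n f) ⟩
  sum< n f                          ∎
  where
  open ≡-Reasoning
  ring : ∀ x y → y ≡ x + y - x
  ring = solve-∀
  ring′ : ∀ x y → y + x - x ≡ y
  ring′ = solve-∀

periodic-shift : ∀ {n f} s → Periodic n f → Periodic n (λ x → f (x + s))
periodic-shift {n} {f} s per x = trans (cong f (ring x (+ n) s)) (per (x + s))
  where
  ring : ∀ x n s → x + n + s ≡ x + s + n
  ring = solve-∀

sum-shiftℕ : ∀ n f m → Periodic n f → sum< n (λ x → f (x + + m)) ≡ sum< n f
sum-shiftℕ n f zero    per = sum-cong λ (k : Fin n) → cong f (ℤ.+-identityʳ (+ toℕ k))
sum-shiftℕ n f (suc m) per = begin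
  sum< n (λ x → f (x + + suc m))
    ≡⟨ sum-cong (λ (k : Fin n) → cong f (sym (ℤ.+-assoc (+ toℕ k) (+ 1) (+ m)))) ⟩
  sum< n (λ x → f (x + + 1 + + m))  ≡⟨ sum-shift₁ n (λ x → f (x + + m)) (periodic-shift {n} {f} (+ m) per) ⟩
  sum< n (λ x → f (x + + m))        ≡⟨ sum-shiftℕ n f m per ⟩
  sum< n f                          ∎
  where open ≡-Reasoning

sum-shift : ∀ n f s → Periodic n f → sum< n (λ x → f (x + s)) ≡ sum< n f
sum-shift n f (+ m)    per = sum-shiftℕ n f m per
sum-shift n f -[1+ m ] per = begin
  sum< n (λ x → f (x + -[1+ m ]))
    ≡⟨ sum-shiftℕ n (λ x → f (x + -[1+ m ])) (suc m) (periodic-shift {n} {f} -[1+ m ] per) ⟨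
  sum< n (λ x → f (x + + suc m + -[1+ m ]))
    ≡⟨ sum-cong (λ (k : Fin n) → cong f (ring (+ toℕ k) (+ suc m))) ⟩
  sum< n f ∎
  where
  open ≡-Reasoning
  ring : ∀ x m → x + m + - m ≡ x
  ring = solve-∀

sum-reverse : ∀ n f → sum< n f ≡ sum< n (λ x → f (+ n - + 1 - x))
sum-reverse zero    f = refl
sum-reverse (suc n) f = begin
  f (+ 0) + sumFin {n} (λ k → f (+ suc (toℕ k)))
    ≡⟨ cong₂ _+_ (cong f (ring (+ n))) (sum-reverse n (λ x → f (+ 1 + x))) ⟩
  f (+ suc n - + 1 - + n) + sumFin {n} (λ k → f (+ 1 + (+ n - + 1 - + toℕ k)))
    ≡⟨ cong₂ _+_ (refl {x = f (+ suc n - + 1 - + n)})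
         (sum-cong λ (k : Fin n) → cong f (ring′ (+ n) (+ toℕ k))) ⟩
  f (+ suc n - + 1 - + n) + sumFin {n} (λ k → f (+ suc n - + 1 - + toℕ k))
    ≡⟨ ℤ.+-comm (f (+ suc n - + 1 - + n)) _ ⟩
  sumFin {n} (λ k → f (+ suc n - + 1 - + toℕ k)) + f (+ suc n - + 1 - + n)
    ≡⟨ sum-snoc n (λ k → f (+ suc n - + 1 - + k)) ⟨
  sum< (suc n) (λ x → f (+ suc n - + 1 - x)) ∎
  where
  open ≡-Reasoning
  ring : ∀ n → + 0 ≡ + 1 + n - + 1 - n
  ring = solve-∀
  ring′ : ∀ n k → + 1 + (n - + 1 - k) ≡ + 1 + n - + 1 - k
  ring′ = solve-∀

-- The reflection is the reversal x ↦ n - 1 - x of one period followed by a shift.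
sum-reflect : ∀ n f s → Periodic n f → sum< n (λ x → f (s - x)) ≡ sum< n f
sum-reflect n f s per = sym (begin
  sum< n f                              ≡⟨ sum-shift n f (s - (+ n - + 1)) per ⟨
  sum< n (λ x → f (x + (s - (+ n - + 1))))  ≡⟨ sum-reverse n (λ x → f (x + (s - (+ n - + 1)))) ⟩
  sum< n (λ x → f (+ n - + 1 - x + (s - (+ n - + 1))))
    ≡⟨ sum-cong (λ (k : Fin n) → cong f (ring (+ n) (+ toℕ k) s)) ⟩
  sum< n (λ x → f (s - x))              ∎)
  where
  open ≡-Reasoning
  ring : ∀ n x s → n - + 1 - x + (s - (n - + 1)) ≡ s - x
  ring = solve-∀

circ : ∀ n → (ℤ → ℤ) → Matrix n
circ n α i j = α (+ toℕ i - + toℕ j)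

conv : ℕ → (ℤ → ℤ) → (ℤ → ℤ) → ℤ → ℤ
conv n α β x = sum< n λ k → α (x - k) * β k

circ-⊗ : ∀ n α β → Periodic n α → Periodic n β → ∀ i j → (circ n α ⊗ circ n β) i j ≡ circ n (conv n α β) i j
circ-⊗ n α β perα perβ i j = begin
  sum< n f                          ≡⟨ sum-shift n f y per ⟨
  sum< n (λ k → f (k + y))          ≡⟨ sum-cong (λ (k : Fin n) → cong₂ (λ u v → α u * β v)
                                         (ring x y (+ toℕ k)) (ring′ y (+ toℕ k))) ⟩
  conv n α β (x - y)                ∎
  where
  open ≡-Reasoning
  x = + toℕ i
  y = + toℕ j
  f : ℤ → ℤ
  f k = α (x - k) * β (k - y)
  ring : ∀ x y k → x - (k + y) ≡ x - y - k
  ring = solve-∀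
  ring′ : ∀ y k → k + y - y ≡ k
  ring′ = solve-∀
  ring″ : ∀ x k n → x - (k + n) + n ≡ x - k
  ring″ = solve-∀
  ring‴ : ∀ y k n → k + n - y ≡ k - y + n
  ring‴ = solve-∀
  per : Periodic n f
  per k = cong₂ _*_ (trans (sym (perα (x - (k + + n)))) (cong α (ring″ x k (+ n))))
                    (trans (cong β (ring‴ y k (+ n))) (perβ (k - y)))

-- The passage from f(x) to f(x) f(-x)

parity : ℤ → ℤ
parity x = sign ∣ x ∣

parity-+1 : ∀ x → parity (x + + 1) ≡ - parity x
parity-+1 (+ n)        = cong sign (ℕ.+-comm n 1)
parity-+1 -[1+ zero ]  = refl
parity-+1 -[1+ suc n ] = sym (ℤ.neg-involutive (- sign n))

parity-+ℕ : ∀ x m → parity (x + + m) ≡ parity x * sign m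
parity-+ℕ x zero    = trans (cong parity (ℤ.+-identityʳ x)) (sym (ℤ.*-identityʳ (parity x)))
parity-+ℕ x (suc m) = begin
  parity (x + + suc m)      ≡⟨ cong parity (ring x (+ m)) ⟩
  parity (x + + m + + 1)    ≡⟨ parity-+1 (x + + m) ⟩
  - parity (x + + m)        ≡⟨ cong -_ (parity-+ℕ x m) ⟩
  - (parity x * sign m)     ≡⟨ ℤ.neg-distribʳ-* (parity x) (sign m) ⟩
  parity x * - sign m       ∎
  where
  open ≡-Reasoning
  ring : ∀ x m → x + (+ 1 + m) ≡ x + m + + 1
  ring = solve-∀

sign-square : ∀ n → sign n * sign n ≡ + 1
sign-square zero    = refl
sign-square (suc n) = trans (ring (sign n)) (sign-square n)
  where
  ring : ∀ x → - x * - x ≡ x * x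
  ring = solve-∀

sign-even : ∀ n → sign (n ℕ.* 2) ≡ + 1
sign-even zero    = refl
sign-even (suc n) = trans (ℤ.neg-involutive _) (sign-even n)

parity-+ : ∀ x y → parity (x + y) ≡ parity x * parity y
parity-+ x (+ m)    = parity-+ℕ x m
parity-+ x -[1+ m ] = begin
  p                              ≡⟨ ℤ.*-identityʳ p ⟨
  p * + 1                        ≡⟨ cong (p *_) (sign-square (suc m)) ⟨
  p * (- sign m * - sign m)      ≡⟨ ℤ.*-assoc p (- sign m) (- sign m) ⟨
  p * - sign m * - sign m        ≡⟨ cong (_* - sign m) (parity-+ℕ (x + -[1+ m ]) (suc m)) ⟨
  parity (x + -[1+ m ] + + suc m) * - sign m
    ≡⟨ cong (λ y → parity y * - sign m) (ring x (+ suc m)) ⟩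
  parity x * - sign m            ∎
  where
  open ≡-Reasoning
  p = parity (x + -[1+ m ])
  ring : ∀ x m → x + - m + m ≡ x
  ring = solve-∀

parity-neg : ∀ x → parity (- x) ≡ parity x
parity-neg x = cong sign (ℤ.∣-i∣≡∣i∣ x)

parity-minus : ∀ x y → parity (x - y) ≡ parity x * parity y
parity-minus x y = trans (parity-+ x (- y)) (cong (parity x *_) (parity-neg y))

-- The coefficients of f(-x). The sign respects residues when the modulus is even, whence the period
-- `n ℕ.* 2` in what follows.
twist : (ℤ → ℤ) → ℤ → ℤ
twist α x = parity x * α x

twist-periodic : ∀ n α → Periodic (n ℕ.* 2) α → Periodic (n ℕ.* 2) (twist α)
twist-periodic n α per x = cong₂ _*_
  (trans (parity-+ℕ x (n ℕ.* 2)) (trans (cong (parity x *_) (sign-even n)) (ℤ.*-identityʳ (parity x))))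
  (per x)

-- The sign of i - j is the product of the signs of i and j, so twisting conjugates the circulant by
-- the diagonal matrix S of signs, and S² is the identity.
det-twist : ∀ n α → det (circ n (twist α)) ≡ det (circ n α)
det-twist n α = begin
  det (circ n (twist α))        ≡⟨ det-cong conjugate ⟩
  det (S ⊗ (circ n α ⊗ S))      ≡⟨ det-⊗ S (circ n α ⊗ S) ⟩
  det S * det (circ n α ⊗ S)    ≡⟨ cong (det S *_) (det-⊗ (circ n α) S) ⟩
  det S * (det (circ n α) * det S) ≡⟨ ring (det S) (det (circ n α)) ⟩
  det S * det S * det (circ n α)   ≡⟨ cong (_* det (circ n α)) (trans (sym (det-⊗ S S))
                                        (trans (det-cong S⊗S) (det-I n))) ⟩
  + 1 * det (circ n α)          ≡⟨ ℤ.*-identityˡ (det (circ n α)) ⟩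
  det (circ n α)                ∎
  where
  open ≡-Reasoning
  s : Fin n → ℤ
  s i = sign (toℕ i)
  S : Matrix n
  S i j = s i * I i j
  ring : ∀ s d → s * (d * s) ≡ s * s * d
  ring = solve-∀
  ring₁ : ∀ s i x → s * i * x ≡ s * x * i
  ring₁ = solve-∀
  ring₂ : ∀ x s i → x * (s * i) ≡ x * s * i
  ring₂ = solve-∀
  ring₃ : ∀ s t x → s * t * x ≡ s * (x * t)
  ring₃ = solve-∀
  S⊗ : ∀ M i j → (S ⊗ M) i j ≡ s i * M i j
  S⊗ M i j = trans
    (sum-cong λ k → trans (ring₁ (s i) (I i k) (M k j)) (cong (s i * M k j *_) (I-sym i k)))
    (sum-I (λ k → s i * M k j) i)
  ⊗S : ∀ M i j → (M ⊗ S) i j ≡ M i j * s j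
  ⊗S M i j = trans (sum-cong λ k → ring₂ (M i k) (s k) (I k j)) (sum-I (λ k → M i k * s k) j)
  conjugate : ∀ i j → circ n (twist α) i j ≡ (S ⊗ (circ n α ⊗ S)) i j
  conjugate i j = trans (cong (_* circ n α i j) (parity-minus (+ toℕ i) (+ toℕ j)))
    (trans (ring₃ (s i) (s j) (circ n α i j))
      (sym (trans (S⊗ (circ n α ⊗ S) i j) (cong (s i *_) (⊗S (circ n α) i j)))))
  S⊗S : ∀ i j → (S ⊗ S) i j ≡ I i j
  S⊗S i j with i Fin.≟ j
  ... | yes refl = trans (S⊗ S i i) (trans (sym (ℤ.*-assoc (s i) (s i) (I i i)))
                     (trans (cong (_* I i i) (sign-square (toℕ i))) (ℤ.*-identityˡ (I i i))))
  ... | no i≢j   = trans (S⊗ S i j) (trans (cong (λ x → s i * (s i * x)) (I-off i≢j))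
                     (trans (ring₀ (s i)) (sym (I-off i≢j))))
    where
    ring₀ : ∀ s → s * (s * + 0) ≡ + 0
    ring₀ = solve-∀

twisted-square : ℕ → (ℤ → ℤ) → ℤ → ℤ
twisted-square n α = conv n α (twist α)

double-cancel : ∀ x → x ≡ - x → x ≡ + 0
double-cancel x e = ℤ.*-cancelˡ-≡ (+ 2) x (+ 0) (trans (ring x) (trans (cong (λ y → x + y) e) (ℤ.+-inverseʳ x)))
  where
  ring : ∀ x → + 2 * x ≡ x + x
  ring = solve-∀

parity-reflect : ∀ x k → parity (+ 2 * x + + 1 - k) ≡ - parity k
parity-reflect x k = begin
  parity (+ 2 * x + + 1 - k)           ≡⟨ parity-minus (+ 2 * x + + 1) k ⟩
  parity (+ 2 * x + + 1) * parity k    ≡⟨ cong (_* parity k) (parity-+1 (+ 2 * x)) ⟩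
  - parity (+ 2 * x) * parity k        ≡⟨ cong (λ y → - parity y * parity k) (double x) ⟩
  - parity (x + x) * parity k
    ≡⟨ cong (λ y → - y * parity k) (trans (parity-+ x x) (sign-square ∣ x ∣)) ⟩
  - + 1 * parity k                     ≡⟨ ℤ.-1*i≡-i (parity k) ⟩
  - parity k                           ∎
  where
  open ≡-Reasoning
  double : ∀ x → + 2 * x ≡ x + x
  double = solve-∀

-- The polynomial f(x) f(-x) is even. In the convolution at an odd y, the substitution k ↦ y - k
-- exchanges the two coefficients and flips the sign, as k and y - k have opposite parity; the sum
-- is its own negative.
twisted-square-odd : ∀ n α → Periodic (n ℕ.* 2) α → ∀ x → twisted-square (n ℕ.* 2) α (+ 2 * x + + 1) ≡ + 0
twisted-square-odd n α per x = double-cancel (twisted-square N α y) (begin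
  sum< N f                 ≡⟨ sum-reflect N f y perf ⟨
  sum< N (λ k → f (y - k)) ≡⟨ sum-cong (λ (k : Fin N) → flip (+ toℕ k)) ⟩
  sumFin {N} (λ k → - + 1 * f (+ toℕ k))  ≡⟨ sum-*ˡ (- + 1) (λ (k : Fin N) → f (+ toℕ k)) ⟩
  - + 1 * sum< N f         ≡⟨ ℤ.-1*i≡-i (sum< N f) ⟩
  - sum< N f               ∎)
  where
  open ≡-Reasoning
  N = n ℕ.* 2
  y = + 2 * x + + 1
  f : ℤ → ℤ
  f k = α (y - k) * twist α k
  ring : ∀ x k n → x - (k + n) + n ≡ x - k
  ring = solve-∀
  ring₁ : ∀ y k → y - (y - k) ≡ k
  ring₁ = solve-∀
  ring₂ : ∀ a p b → a * (- p * b) ≡ - + 1 * (b * (p * a))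
  ring₂ = solve-∀
  perf : Periodic N f
  perf k = cong₂ _*_ (trans (sym (per (y - (k + + N)))) (cong α (ring y k (+ N))))
                     (twist-periodic n α per k)
  flip : ∀ k → f (y - k) ≡ - + 1 * f k
  flip k = trans (cong₂ (λ u p → α u * (p * α (y - k))) (ring₁ y k) (parity-reflect x k))
                 (ring₂ (α k) (parity k) (α (y - k)))

-- The coefficients of the g with g(x²) = f(x) f(-x).
halve : ∀ n α → ℤ → ℤ
halve n α x = twisted-square (n ℕ.* 2) α (+ 2 * x)

conv-periodic : ∀ n α β → Periodic n α → Periodic n (conv n α β)
conv-periodic n α β per x = sum-cong λ (k : Fin n) → cong (_* β (+ toℕ k))
  (trans (cong α (ring x (+ n) (+ toℕ k))) (per (x - + toℕ k)))
  where
  ring : ∀ x n k → x + n - k ≡ x - k + n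
  ring = solve-∀

halve-periodic : ∀ n α → Periodic (n ℕ.* 2) α → Periodic n (halve n α)
halve-periodic n α per x = trans (cong (twisted-square N α) (trans (ring x (+ n))
    (cong (λ y → + 2 * x + y) (sym (ℤ.pos-* n 2)))))
  (conv-periodic N α (twist α) per (+ 2 * x))
  where
  N = n ℕ.* 2
  ring : ∀ x n → + 2 * (x + n) ≡ + 2 * x + n * + 2
  ring = solve-∀

evens-odds : ∀ n → Fin (n ℕ.* 2) ↔ (Fin n ⊎ Fin n)
evens-odds n = mk↔ₛ′ (split ∘ remQuot {n} 2) merge split-merge merge-split
  where
  split : Fin n × Fin 2 → Fin n ⊎ Fin n
  split (q , zero)     = inj₁ q
  split (q , suc zero) = inj₂ q
  merge : Fin n ⊎ Fin n → Fin (n ℕ.* 2)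
  merge (inj₁ q) = combine q zero
  merge (inj₂ q) = combine q (suc zero)
  split-merge : ∀ x → split (remQuot {n} 2 (merge x)) ≡ x
  split-merge (inj₁ q) = cong split (Fin.remQuot-combine q (zero {1}))
  split-merge (inj₂ q) = cong split (Fin.remQuot-combine q (suc (zero {0})))
  merge-split : ∀ i → merge (split (remQuot {n} 2 i)) ≡ i
  merge-split i = trans (lemma (remQuot {n} 2 i)) (Fin.combine-remQuot {n} 2 i)
    where
    lemma : ∀ x → merge (split x) ≡ combine (x .proj₁) (x .proj₂)
    lemma (q , zero)     = refl
    lemma (q , suc zero) = refl

det-halve : ∀ n α → Periodic (n ℕ.* 2) α →
  det (circ (n ℕ.* 2) α) * det (circ (n ℕ.* 2) α) ≡ det (circ n (halve n α)) * det (circ n (halve n α))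
det-halve n α per = begin
  det (circ N α) * det (circ N α)          ≡⟨ cong (det (circ N α) *_) (det-twist N α) ⟨
  det (circ N α) * det (circ N (twist α))  ≡⟨ det-⊗ (circ N α) (circ N (twist α)) ⟨
  det (circ N α ⊗ circ N (twist α))
    ≡⟨ det-cong (λ i j → trans (circ-⊗ N α (twist α) per (twist-periodic n α per) i j) (blocks i j)) ⟩
  det (block (circ n (halve n α)) (circ n (halve n α)))
    ≡⟨ det-block (circ n (halve n α)) (circ n (halve n α)) ⟩
  det (circ n (halve n α)) * det (circ n (halve n α)) ∎
  where
  open ≡-Reasoning
  open Block (evens-odds n)
  open Inverse (evens-odds n)
  N = n ℕ.* 2
  A = circ n (halve n α)
  position : Fin n ⊎ Fin n → ℤ
  position (inj₁ q) = + 2 * + toℕ q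
  position (inj₂ q) = + 2 * + toℕ q + + 1
  from-position : ∀ x → + toℕ (from x) ≡ position x
  from-position (inj₁ q) = trans (cong +_ (trans (Fin.toℕ-combine q (zero {1})) (ℕ.+-identityʳ _)))
                                 (ℤ.pos-* 2 (toℕ q))
  from-position (inj₂ q) = trans (cong +_ (Fin.toℕ-combine q (suc (zero {0}))))
                                 (cong (λ x → x + + 1) (ℤ.pos-* 2 (toℕ q)))
  to-position : ∀ i → + toℕ i ≡ position (to i)
  to-position i = trans (cong (+_ ∘ toℕ) (sym (strictlyInverseʳ i))) (from-position (to i))
  ring₁ : ∀ a b → + 2 * a - + 2 * b ≡ + 2 * (a - b)
  ring₁ = solve-∀
  ring₂ : ∀ a b → + 2 * a - (+ 2 * b + + 1) ≡ + 2 * (a - b - + 1) + + 1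
  ring₂ = solve-∀
  ring₃ : ∀ a b → + 2 * a + + 1 - + 2 * b ≡ + 2 * (a - b) + + 1
  ring₃ = solve-∀
  ring₄ : ∀ a b → + 2 * a + + 1 - (+ 2 * b + + 1) ≡ + 2 * (a - b)
  ring₄ = solve-∀
  at-positions : ∀ x y → twisted-square N α (position x - position y) ≡ entry A A x y
  at-positions (inj₁ i) (inj₁ j) = cong (twisted-square N α) (ring₁ (+ toℕ i) (+ toℕ j))
  at-positions (inj₁ i) (inj₂ j) = trans (cong (twisted-square N α) (ring₂ (+ toℕ i) (+ toℕ j)))
                                         (twisted-square-odd n α per (+ toℕ i - + toℕ j - + 1))
  at-positions (inj₂ i) (inj₁ j) = trans (cong (twisted-square N α) (ring₃ (+ toℕ i) (+ toℕ j)))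
                                         (twisted-square-odd n α per (+ toℕ i - + toℕ j))
  at-positions (inj₂ i) (inj₂ j) = cong (twisted-square N α) (ring₄ (+ toℕ i) (+ toℕ j))
  blocks : ∀ i j → circ N (twisted-square N α) i j ≡ block A A i j
  blocks i j = trans (cong₂ (λ x y → twisted-square N α (x - y)) (to-position i) (to-position j))
                     (at-positions (to i) (to j))

remainder-unique : ∀ n .{{_ : ℕ.NonZero n}} x y → + n ∣ℤ x - y → x %ℕ n ≡ y %ℕ n
remainder-unique n x y (divides q e) = close (∣⇒∣ᵤ n∣r-s)
  where
  r = x %ℕ n
  s = y %ℕ n
  ring : ∀ r s a b q n x y → x ≡ r + a * n → y ≡ s + b * n → x - y ≡ q * n → r - s ≡ (q - a + b) * n
  ring r s a b q n _ _ refl refl e = trans (ring₁ r s a b n)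
    (trans (cong (λ z → z - a * n + b * n) e) (ring₂ a b q n))
    where
    ring₁ : ∀ r s a b n → r - s ≡ r + a * n - (s + b * n) - a * n + b * n
    ring₁ = solve-∀
    ring₂ : ∀ a b q n → q * n - a * n + b * n ≡ (q - a + b) * n
    ring₂ = solve-∀
  n∣r-s : + n ∣ℤ + r - + s
  n∣r-s = divides (q - x /ℕ n + y /ℕ n) (ring (+ r) (+ s) (x /ℕ n) (y /ℕ n) q (+ n) x y
    (ℤ.a≡a%ℕn+[a/ℕn]*n x n) (ℤ.a≡a%ℕn+[a/ℕn]*n y n) e)
  small : ∣ + r - + s ∣ ℕ.< n
  small = ℕ.≤-<-trans (subst (ℕ._≤ r ℕ.⊔ s) (cong ∣_∣ (sym (ℤ.m-n≡m⊖n r s))) (ℤ.∣m⊝n∣≤m⊔n r s))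
                      (ℕ.⊔-lub (ℤ.n%ℕd<d x n) (ℤ.n%ℕd<d y n))
  close : n ℕ.∣ ∣ + r - + s ∣ → r ≡ s
  close d with ∣ + r - + s ∣ in eq
  ... | zero  = ℤ.+-injective (ℤ.i-j≡0⇒i≡j (+ r) (+ s) (ℤ.∣i∣≡0⇒i≡0 eq))
  ... | suc k = contradiction (subst (ℕ._< n) eq small) (ℕ.≤⇒≯ (ℕ.∣⇒≤ d))

periodise : ∀ {A : Set} {n} .{{_ : ℕ.NonZero n}} → (Fin n → A) → ℤ → A
periodise {n = n} a x = a (fromℕ< (ℤ.n%ℕd<d x n))

periodise-periodic : ∀ {n} .{{_ : ℕ.NonZero n}} (a : Fin n → ℤ) → Periodic n (periodise a)
periodise-periodic {n} a x = cong a (Fin.fromℕ<-cong _ _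
  (remainder-unique n (x + + n) x (divides (+ 1) (ring x (+ n)))) _ _)
  where
  ring : ∀ x n → x + n - x ≡ + 1 * n
  ring = solve-∀

-- To stay in ℕ, `circulant` uses the index i + (size - j), which is one period above i - j.
circulant≡circ : ∀ n a i j → circulant n a i j ≡ circ (suc n) (periodise a) i j
circulant≡circ n a i j = trans (cong (periodise a) shifted) (periodise-periodic a (+ toℕ i - + toℕ j))
  where
  ring : ∀ i j n → i + (n - j) ≡ i - j + n
  ring = solve-∀
  shifted : + (toℕ i ℕ.+ (suc n ℕ.∸ toℕ j)) ≡ + toℕ i - + toℕ j + + suc n
  shifted = trans (cong (λ x → + toℕ i + x) (trans (sym (ℤ.⊖-≥ (ℕ.<⇒≤ (Fin.toℕ<n j))))
    (sym (ℤ.m-n≡m⊖n (suc n) (toℕ j))))) (ring (+ toℕ i) (+ toℕ j) (+ suc n))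

periodise-toℕ : ∀ {n} .{{_ : ℕ.NonZero n}} α → Periodic n α →
                ∀ x → periodise {n = n} (λ i → α (+ toℕ i)) x ≡ α x
periodise-toℕ {n} α per x = begin
  α (+ toℕ (fromℕ< (ℤ.n%ℕd<d x n)))  ≡⟨ cong (α ∘ +_) (Fin.toℕ-fromℕ< _) ⟩
  α (+ (x %ℕ n))                     ≡⟨ multiples (+ (x %ℕ n)) (x /ℕ n) ⟨
  α (+ (x %ℕ n) + x /ℕ n * + n)      ≡⟨ cong α (ℤ.a≡a%ℕn+[a/ℕn]*n x n) ⟨
  α x                                ∎
  where
  open ≡-Reasoning
  ring₀ : ∀ y n → y + + 0 * n ≡ y
  ring₀ = solve-∀
  ring₁ : ∀ y q n → y + (+ 1 + q) * n ≡ y + q * n + n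
  ring₁ = solve-∀
  ring₂ : ∀ y q n → y + - q * n + q * n ≡ y
  ring₂ = solve-∀
  multiplesℕ : ∀ y m → α (y + + m * + n) ≡ α y
  multiplesℕ y zero    = cong α (ring₀ y (+ n))
  multiplesℕ y (suc m) = trans (cong α (ring₁ y (+ m) (+ n)))
    (trans (per (y + + m * + n)) (multiplesℕ y m))
  multiples : ∀ y q → α (y + q * + n) ≡ α y
  multiples y (+ m)    = multiplesℕ y m
  multiples y -[1+ m ] = trans (sym (multiplesℕ (y + -[1+ m ] * + n) (suc m)))
    (cong α (ring₂ y (+ suc m) (+ n)))

-- Norms of f at the sixteenth roots of unity

-- Opaque, so that conversion checking does not unfold determinants and their entries.
opaque
  norm : ∀ n → (Fin (suc n) → ℤ) → ℤ
  norm n a = det (circ (suc n) (periodise a))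

  fold : ∀ n → (Fin (suc n ℕ.* 2) → ℤ) → Fin (suc n) → ℤ
  fold n a i = halve (suc n) (periodise a) (+ toℕ i)

  norm-fold : ∀ n a → norm (suc (n ℕ.* 2)) a * norm (suc (n ℕ.* 2)) a ≡ norm n (fold n a) * norm n (fold n a)
  norm-fold n a = trans (det-halve (suc n) (periodise a) (periodise-periodic a))
    (cong (λ x → x * x) (det-cong {suc n} λ i j → sym (periodise-toℕ (halve (suc n) (periodise a))
      (halve-periodic (suc n) (periodise a) (periodise-periodic a)) (+ toℕ i - + toℕ j))))

-- The remainders modulo xⁿ - 1 and xⁿ + 1 of a polynomial given modulo x²ⁿ - 1.
plus minus : ∀ n → (Fin (n ℕ.+ n) → ℤ) → Fin n → ℤ
plus  n a i = a (i ↑ˡ n) + a (n ↑ʳ i)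
minus n a i = a (i ↑ˡ n) - a (n ↑ʳ i)

-- For d the coefficients of an element z of ℤ[ζ₈], the norm of z to ℤ[i] is re d + im d · i.
re im : (Fin 4 → ℤ) → ℤ
re d = d 0F * d 0F - d 2F * d 2F + + 2 * (d 1F * d 3F)
im d = d 3F * d 3F - d 1F * d 1F + + 2 * (d 0F * d 2F)

-- For c the coefficients of an element of ℤ[ζ₁₆], its norm to ℤ[ζ₈].
descend : (Fin 8 → ℤ) → Fin 4 → ℤ
descend c 0F = c 0F * c 0F - c 4F * c 4F + + 2 * (c 1F * c 7F + c 3F * c 5F - c 2F * c 6F)
descend c 1F = c 5F * c 5F - c 1F * c 1F + + 2 * (c 0F * c 2F - c 4F * c 6F + c 3F * c 7F)
descend c 2F = c 2F * c 2F - c 6F * c 6F + + 2 * (c 0F * c 4F - c 1F * c 3F + c 5F * c 7F)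
descend c 3F = c 7F * c 7F - c 3F * c 3F + + 2 * (c 0F * c 6F + c 2F * c 4F - c 1F * c 5F)

-- Symbolic mirrors of fold, plus, … for the ring solver: `prove` evaluates them back definitionally.
module _ {m : ℕ} where
  sumP : ∀ {n} → (Fin n → Polynomial m) → Polynomial m
  sumP {zero}  f = con (+ 0)
  sumP {suc n} f = f zero :+ sumP (λ i → f (suc i))

  foldP : ∀ n → (Fin (suc n ℕ.* 2) → Polynomial m) → Fin (suc n) → Polynomial m
  foldP n v i = sumP λ (k : Fin (suc n ℕ.* 2)) →
    periodise v (+ 2 * + toℕ i - + toℕ k) :* (con (parity (+ toℕ k)) :* periodise v (+ toℕ k))

  plusP minusP : ∀ n → (Fin (n ℕ.+ n) → Polynomial m) → Fin n → Polynomial m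
  plusP  n a i = a (i ↑ˡ n) :+ a (n ↑ʳ i)
  minusP n a i = a (i ↑ˡ n) :- a (n ↑ʳ i)

  reP imP : (Fin 4 → Polynomial m) → Polynomial m
  reP d = d 0F :* d 0F :- d 2F :* d 2F :+ con (+ 2) :* (d 1F :* d 3F)
  imP d = d 3F :* d 3F :- d 1F :* d 1F :+ con (+ 2) :* (d 0F :* d 2F)

  descendP : (Fin 8 → Polynomial m) → Fin 4 → Polynomial m
  descendP c 0F = c 0F :* c 0F :- c 4F :* c 4F :+
    con (+ 2) :* (c 1F :* c 7F :+ c 3F :* c 5F :- c 2F :* c 6F)
  descendP c 1F = c 5F :* c 5F :- c 1F :* c 1F :+
    con (+ 2) :* (c 0F :* c 2F :- c 4F :* c 6F :+ c 3F :* c 7F)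
  descendP c 2F = c 2F :* c 2F :- c 6F :* c 6F :+
    con (+ 2) :* (c 0F :* c 4F :- c 1F :* c 3F :+ c 5F :* c 7F)
  descendP c 3F = c 7F :* c 7F :- c 3F :* c 3F :+
    con (+ 2) :* (c 0F :* c 6F :+ c 2F :* c 4F :- c 1F :* c 5F)

opaque
  unfolding fold norm

  fold-2 : ∀ k → fold 0 k 0F ≡ (k 0F + k 1F) * (k 0F - k 1F)
  fold-2 k = prove (tabulate k) (foldP 0 var 0F) ((var 0F :+ var 1F) :* (var 0F :- var 1F)) refl

  fold-4-plus : ∀ h → fold 1 h 0F + fold 1 h 1F ≡
                (h 0F + h 2F) * (h 0F + h 2F) - (h 1F + h 3F) * (h 1F + h 3F)
  fold-4-plus h = prove (tabulate h) (foldP 1 var 0F :+ foldP 1 var 1F)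
    ((var 0F :+ var 2F) :* (var 0F :+ var 2F) :- (var 1F :+ var 3F) :* (var 1F :+ var 3F)) refl

  fold-4-minus : ∀ h → fold 1 h 0F - fold 1 h 1F ≡
                 (h 0F - h 2F) * (h 0F - h 2F) + (h 1F - h 3F) * (h 1F - h 3F)
  fold-4-minus h = prove (tabulate h) (foldP 1 var 0F :- foldP 1 var 1F)
    ((var 0F :- var 2F) :* (var 0F :- var 2F) :+ (var 1F :- var 3F) :* (var 1F :- var 3F)) refl

  -- If g(x) g(-x) = h(x²), then h modulo x² - 1 depends only on g modulo x⁴ - 1, and h modulo x² +
  -- 1 only on g modulo x⁴ + 1, where it is a relative norm. The identities for length 16 say the
  -- same one level higher.
  fold-8-plus : ∀ g i → plus 2 (fold 3 g) i ≡ fold 1 (plus 4 g) i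
  fold-8-plus g 0F = prove (tabulate g) (plusP 2 (foldP 3 var) 0F) (foldP 1 (plusP 4 var) 0F) refl
  fold-8-plus g 1F = prove (tabulate g) (plusP 2 (foldP 3 var) 1F) (foldP 1 (plusP 4 var) 1F) refl

  fold-8-re : ∀ g → minus 2 (fold 3 g) 0F ≡ re (minus 4 g)
  fold-8-re g = prove (tabulate g) (minusP 2 (foldP 3 var) 0F) (reP (minusP 4 var)) refl

  fold-8-im : ∀ g → minus 2 (fold 3 g) 1F ≡ im (minus 4 g)
  fold-8-im g = prove (tabulate g) (minusP 2 (foldP 3 var) 1F) (imP (minusP 4 var)) refl

  fold-16-plus : ∀ a i → plus 4 (fold 7 a) i ≡ fold 3 (plus 8 a) i
  fold-16-plus a 0F = prove (tabulate a) (plusP 4 (foldP 7 var) 0F) (foldP 3 (plusP 8 var) 0F) refl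
  fold-16-plus a 1F = prove (tabulate a) (plusP 4 (foldP 7 var) 1F) (foldP 3 (plusP 8 var) 1F) refl
  fold-16-plus a 2F = prove (tabulate a) (plusP 4 (foldP 7 var) 2F) (foldP 3 (plusP 8 var) 2F) refl
  fold-16-plus a 3F = prove (tabulate a) (plusP 4 (foldP 7 var) 3F) (foldP 3 (plusP 8 var) 3F) refl

  fold-16-minus : ∀ a i → minus 4 (fold 7 a) i ≡ descend (minus 8 a) i
  fold-16-minus a 0F = prove (tabulate a) (minusP 4 (foldP 7 var) 0F) (descendP (minusP 8 var) 0F) refl
  fold-16-minus a 1F = prove (tabulate a) (minusP 4 (foldP 7 var) 1F) (descendP (minusP 8 var) 1F) refl
  fold-16-minus a 2F = prove (tabulate a) (minusP 4 (foldP 7 var) 2F) (descendP (minusP 8 var) 2F) refl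
  fold-16-minus a 3F = prove (tabulate a) (minusP 4 (foldP 7 var) 3F) (descendP (minusP 8 var) 3F) refl

  fold-cong : ∀ n {a a′} → (∀ i → a i ≡ a′ i) → ∀ i → fold n a i ≡ fold n a′ i
  fold-cong n {a} {a′} e i = sum-cong λ (k : Fin (suc n ℕ.* 2)) →
    cong₂ (λ x y → x * (parity (+ toℕ k) * y))
      (periodise-cong (+ 2 * + toℕ i - + toℕ k)) (periodise-cong (+ toℕ k))
    where
    periodise-cong : ∀ x → periodise a x ≡ periodise a′ x
    periodise-cong x = e (fromℕ< (ℤ.n%ℕd<d x (suc n ℕ.* 2)))

  norm-1 : ∀ l → norm 0 l ≡ l 0F
  norm-1 l = ring (l 0F)
    where
    ring : ∀ x → + 1 * (x * + 1) + + 0 ≡ x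
    ring = solve-∀

  norm-circulant : ∀ n a → det (circulant n a) ≡ norm n a
  norm-circulant n a = det-cong (circulant≡circ n a)

sumSquares : ℤ → ℤ → ℤ
sumSquares x y = x * x + y * y

re-cong : ∀ {d d′} → (∀ i → d i ≡ d′ i) → re d ≡ re d′
re-cong e rewrite e 0F | e 1F | e 2F | e 3F = refl

im-cong : ∀ {d d′} → (∀ i → d i ≡ d′ i) → im d ≡ im d′
im-cong e rewrite e 0F | e 1F | e 2F | e 3F = refl

rational : (Fin 4 → ℤ) → ℤ
rational s = (s 0F + s 2F) * (s 0F + s 2F) - (s 1F + s 3F) * (s 1F + s 3F)

-- f(1) f(-1) · N(f(i)) · N(f(ζ₈)) · N(f(ζ₁₆)) for the polynomial f with coefficients a.
values : (Fin 16 → ℤ) → ℤ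
values a = rational s * sumSquares (s 0F - s 2F) (s 1F - s 3F) *
           sumSquares (re d) (im d) * sumSquares (re G) (im G)
  where
  s = plus 4 (plus 8 a)
  d = minus 4 (plus 8 a)
  G = descend (minus 8 a)

-- Each difference of squares splits into a sum and a difference. The difference is a norm at a
-- primitive root of unity, of order 16, then 8, then 4; the sum passes to the next level, down to
-- f(1) f(-1).
fold-values : ∀ a → fold 0 (fold 1 (fold 3 (fold 7 a))) 0F ≡ values a
fold-values a = begin
  fold 0 (fold 1 (fold 3 g)) 0F
    ≡⟨ fold-2 (fold 1 (fold 3 g)) ⟩
  (fold 1 (fold 3 g) 0F + fold 1 (fold 3 g) 1F) * (fold 1 (fold 3 g) 0F - fold 1 (fold 3 g) 1F)
    ≡⟨ cong₂ _*_ (fold-4-plus (fold 3 g)) (fold-4-minus (fold 3 g)) ⟩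
  (plus 2 (fold 3 g) 0F * plus 2 (fold 3 g) 0F - plus 2 (fold 3 g) 1F * plus 2 (fold 3 g) 1F) *
  sumSquares (minus 2 (fold 3 g) 0F) (minus 2 (fold 3 g) 1F)
    ≡⟨ cong₂ _*_ (cong₂ (λ x y → x * x - y * y) (plus-8 0F) (plus-8 1F))
         (cong₂ sumSquares (trans (fold-8-re g) (re-cong (fold-16-minus a)))
                           (trans (fold-8-im g) (im-cong (fold-16-minus a)))) ⟩
  (k 0F * k 0F - k 1F * k 1F) * sumSquares (re G) (im G)
    ≡⟨ cong (_* sumSquares (re G) (im G)) (trans (difference (k 0F) (k 1F)) (cong₂ _*_
         (trans (fold-4-plus (fold 3 b)) (trans
           (cong₂ (λ x y → x * x - y * y) (fold-8-plus b 0F) (fold-8-plus b 1F))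
           (trans (difference (fold 1 s 0F) (fold 1 s 1F))
             (cong₂ _*_ (fold-4-plus s) (fold-4-minus s)))))
         (trans (fold-4-minus (fold 3 b)) (cong₂ sumSquares (fold-8-re b) (fold-8-im b))))) ⟩
  values a ∎
  where
  open ≡-Reasoning
  g = fold 7 a
  b = plus 8 a
  s = plus 4 b
  d = minus 4 b
  G = descend (minus 8 a)
  k = fold 1 (fold 3 b)
  difference : ∀ x y → x * x - y * y ≡ (x + y) * (x - y)
  difference = solve-∀
  plus-8 : ∀ i → plus 2 (fold 3 g) i ≡ k i
  plus-8 i = trans (fold-8-plus g i) (fold-cong 1 (fold-16-plus a) i)

D16-square : ∀ a → D16 a * D16 a ≡ values a * values a
D16-square a = begin
  D16 a * D16 a                  ≡⟨ cong (λ x → x * x) (norm-circulant 15 a) ⟩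
  norm 15 a * norm 15 a          ≡⟨ norm-fold 7 a ⟩
  norm 7 g * norm 7 g            ≡⟨ norm-fold 3 g ⟩
  norm 3 h * norm 3 h            ≡⟨ norm-fold 1 h ⟩
  norm 1 k * norm 1 k            ≡⟨ norm-fold 0 k ⟩
  norm 0 l * norm 0 l            ≡⟨ cong (λ x → x * x) (trans (norm-1 l) (fold-values a)) ⟩
  values a * values a            ∎
  where
  open ≡-Reasoning
  g = fold 7 a
  h = fold 3 g
  k = fold 1 h
  l = fold 0 k

-- Sums of two squares

residue : ∀ n .{{_ : ℕ.NonZero n}} → ℕ → Fin n
residue n m = fromℕ< (ℕ.m%n<n m n)

toℕ-residue : ∀ n .{{_ : ℕ.NonZero n}} m → toℕ (residue n m) ≡ m ℕ.% n
toℕ-residue n m = Fin.toℕ-fromℕ< (ℕ.m%n<n m n)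

even-summand : ∀ u v → (u ℕ.+ v) ℕ.% 4 ≡ 3 → (u ℕ.* u) ℕ.% 4 ≡ 0 ⊎ (v ℕ.* v) ℕ.% 4 ≡ 0
even-summand u v e = Sum.map (trans (square u)) (trans (square v))
  (check (residue 4 u) (residue 4 v) (trans (cong₂ (λ x y → (x ℕ.+ y) ℕ.% 4)
    (toℕ-residue 4 u) (toℕ-residue 4 v)) (trans (sym (ℕ.%-distribˡ-+ u v 4)) e)))
  where
  check : ∀ (u v : Fin 4) → (toℕ u ℕ.+ toℕ v) ℕ.% 4 ≡ 3 →
          (toℕ u ℕ.* toℕ u) ℕ.% 4 ≡ 0 ⊎ (toℕ v ℕ.* toℕ v) ℕ.% 4 ≡ 0
  check = from-yes (Fin.all? λ (u : Fin 4) → Fin.all? λ (v : Fin 4) →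
    ((toℕ u ℕ.+ toℕ v) ℕ.% 4 ℕ.≟ 3) →-dec
    (((toℕ u ℕ.* toℕ u) ℕ.% 4 ℕ.≟ 0) ⊎-dec ((toℕ v ℕ.* toℕ v) ℕ.% 4 ℕ.≟ 0)))
  square : ∀ u → (u ℕ.* u) ℕ.% 4 ≡ (toℕ (residue 4 u) ℕ.* toℕ (residue 4 u)) ℕ.% 4
  square u = trans (ℕ.%-distribˡ-* u u 4)
    (sym (cong (λ x → (x ℕ.* x) ℕ.% 4) (toℕ-residue 4 u)))

cofactor≡3 : ∀ k n → n ℕ.% 4 ≡ 3 → (k ℕ.* n) ℕ.% 4 ≡ 1 → k ℕ.% 4 ≡ 3
cofactor≡3 k n n≡3 kn≡1 = trans (sym (toℕ-residue 4 k)) (check (residue 4 k) (begin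
  (toℕ (residue 4 k) ℕ.* 3) ℕ.% 4      ≡⟨ cong₂ (λ x y → (x ℕ.* y) ℕ.% 4) (toℕ-residue 4 k) (sym n≡3) ⟩
  (k ℕ.% 4 ℕ.* (n ℕ.% 4)) ℕ.% 4        ≡⟨ ℕ.%-distribˡ-* k n 4 ⟨
  (k ℕ.* n) ℕ.% 4                      ≡⟨ kn≡1 ⟩
  1 ∎))
  where
  open ≡-Reasoning
  check : ∀ (k : Fin 4) → (toℕ k ℕ.* 3) ℕ.% 4 ≡ 1 → toℕ k ≡ 3
  check = from-yes (Fin.all? λ (k : Fin 4) → ((toℕ k ℕ.* 3) ℕ.% 4 ℕ.≟ 1) →-dec (toℕ k ℕ.≟ 3))

-- Descent: an even square root e < n of -1 gives e² + 1 = k n with k < n and k ≡ 3 mod 4.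
-1-nonresidue : ∀ n → n ℕ.% 4 ≡ 3 → ∀ x → ¬ n ℕ.∣ x ℕ.* x ℕ.+ 1
-1-nonresidue = <-rec _ step
  where
  even-root : ∀ n → n ℕ.% 4 ≡ 3 → ∀ x → n ℕ.∣ x ℕ.* x ℕ.+ 1 →
              ∃ λ e → e < n × (e ℕ.* e) ℕ.% 4 ≡ 0 × n ℕ.∣ e ℕ.* e ℕ.+ 1
  even-root n@(suc n′) n≡3 x n∣ = choose (even-summand r r′ (trans (cong (ℕ._% 4) r+r′≡n) n≡3))
    where
    -- Both r and n - r are roots, and one of them is even because their sum n is odd.
    r  = x ℕ.% n
    r′ = n ℕ.∸ r
    r+r′≡n : r ℕ.+ r′ ≡ n
    r+r′≡n = ℕ.m+[n∸m]≡n (ℕ.<⇒≤ (ℕ.m%n<n x n))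
    n∣r²+1 : n ℕ.∣ r ℕ.* r ℕ.+ 1
    n∣r²+1 = ℕ.m%n≡0⇒n∣m _ n (begin
      (r ℕ.* r ℕ.+ 1) ℕ.% n                ≡⟨ ℕ.%-distribˡ-+ (r ℕ.* r) 1 n ⟩
      ((r ℕ.* r) ℕ.% n ℕ.+ 1 ℕ.% n) ℕ.% n  ≡⟨ cong (λ z → (z ℕ.+ 1 ℕ.% n) ℕ.% n) (ℕ.%-distribˡ-* x x n) ⟨
      ((x ℕ.* x) ℕ.% n ℕ.+ 1 ℕ.% n) ℕ.% n  ≡⟨ ℕ.%-distribˡ-+ (x ℕ.* x) 1 n ⟨
      (x ℕ.* x ℕ.+ 1) ℕ.% n                ≡⟨ ℕ.n∣m⇒m%n≡0 _ n n∣ ⟩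
      0 ∎)
      where open ≡-Reasoning
    n∣r′²+1 : n ℕ.∣ r′ ℕ.* r′ ℕ.+ 1
    n∣r′²+1 = ℕ.∣m+n∣m⇒∣n (subst (n ℕ.∣_) balance
      (ℕ.∣m∣n⇒∣m+n (ℕ.n∣m*n r′) n∣r²+1)) (ℕ.n∣m*n r)
      where
      ring : ∀ r s → s ℕ.* (r ℕ.+ s) ℕ.+ (r ℕ.* r ℕ.+ 1) ≡ r ℕ.* (r ℕ.+ s) ℕ.+ (s ℕ.* s ℕ.+ 1)
      ring = solveℕ-∀
      balance : r′ ℕ.* n ℕ.+ (r ℕ.* r ℕ.+ 1) ≡ r ℕ.* n ℕ.+ (r′ ℕ.* r′ ℕ.+ 1)
      balance = subst (λ z → r′ ℕ.* z ℕ.+ (r ℕ.* r ℕ.+ 1) ≡ r ℕ.* z ℕ.+ (r′ ℕ.* r′ ℕ.+ 1)) r+r′≡n (ring r r′)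
    choose : (r ℕ.* r) ℕ.% 4 ≡ 0 ⊎ (r′ ℕ.* r′) ℕ.% 4 ≡ 0 → _
    choose (inj₁ even) = r , ℕ.m%n<n x n , even , n∣r²+1
    choose (inj₂ even) with ℕ.m≤n⇒m<n∨m≡n (ℕ.m∸n≤m n r)
    ... | inj₁ r′<n = r′ , r′<n , even , n∣r′²+1
    -- Here n itself is a root, so n divides 1 and 0 is an even root below n.
    ... | inj₂ r′≡n = 0 , s≤s z≤n , refl , ℕ.∣m+n∣m⇒∣n
      (subst (λ z → n ℕ.∣ z ℕ.* z ℕ.+ 1) r′≡n n∣r′²+1) (ℕ.m∣m*n n)
  step : ∀ n → (∀ {k} → k < n → k ℕ.% 4 ≡ 3 → ∀ x → ¬ k ℕ.∣ x ℕ.* x ℕ.+ 1) →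
         n ℕ.% 4 ≡ 3 → ∀ x → ¬ n ℕ.∣ x ℕ.* x ℕ.+ 1
  step n@(suc (suc n″)) rec n≡3 x n∣ with even-root n n≡3 x n∣
  ... | e , e<n , even , ℕ.divides k eq = rec k<n k≡3 e (ℕ.divides n (trans eq (ℕ.*-comm k n)))
    where
    k≡3 : k ℕ.% 4 ≡ 3
    k≡3 = cofactor≡3 k n n≡3 (trans (cong (ℕ._% 4) (sym eq))
      (trans (ℕ.%-distribˡ-+ (e ℕ.* e) 1 4) (cong (λ z → (z ℕ.+ 1) ℕ.% 4) even)))
    k<n : k < n
    k<n = ℕ.*-cancelʳ-< n k n (begin-strict
      k ℕ.* n                  ≡⟨ eq ⟨
      e ℕ.* e ℕ.+ 1            ≤⟨ ℕ.+-monoˡ-≤ 1 (ℕ.*-mono-≤ (ℕ.≤-pred e<n) (ℕ.≤-pred e<n)) ⟩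
      suc n″ ℕ.* suc n″ ℕ.+ 1  <⟨ ℕ.m<m+n _ (s≤s z≤n) ⟩
      suc n″ ℕ.* suc n″ ℕ.+ 1 ℕ.+ suc (n″ ℕ.+ suc n″)  ≡⟨ ring n″ ⟩
      n ℕ.* n                  ∎)
      where
      open ℕ.≤-Reasoning
      ring : ∀ n → (1 ℕ.+ n) ℕ.* (1 ℕ.+ n) ℕ.+ 1 ℕ.+ (1 ℕ.+ (n ℕ.+ (1 ℕ.+ n))) ≡ (2 ℕ.+ n) ℕ.* (2 ℕ.+ n)
      ring = solveℕ-∀

square-abs : ∀ i → i * i ≡ + (∣ i ∣ ℕ.* ∣ i ∣)
square-abs (+ n)    = sym (ℤ.pos-* n n)
square-abs -[1+ n ] = refl

module _ {p} (pr : Prime p) where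
  euclid-ℤ : ∀ x y → + p ∣ℤ x * y → + p ∣ℤ x ⊎ + p ∣ℤ y
  euclid-ℤ x y d = Sum.map ∣ᵤ⇒∣ ∣ᵤ⇒∣
    (euclidsLemma ∣ x ∣ ∣ y ∣ pr (subst (p ℕ.∣_) (ℤ.abs-* x y) (∣⇒∣ᵤ d)))

  ∣x²⇒∣x : ∀ x → + p ∣ℤ x * x → + p ∣ℤ x
  ∣x²⇒∣x x d = [ id , id ]′ (euclid-ℤ x x d)

  -- Bézout gives w · ∣y∣ ≡ ±1 mod p. Squaring absorbs both this sign and the absolute value, and
  -- only (wy)² ≡ 1 is needed for a square root of -1.
  inverse-square : ∀ y → ¬ (+ p ∣ℤ y) → ∃ λ w → + p ∣ℤ w * y * (w * y) - + 1
  inverse-square y p∤y = from-Bézout (coprime-Bézout coprime)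
    where
    coprime : Coprime p ∣ y ∣
    coprime (d∣p , d∣y) with prime⇒irreducible pr d∣p
    ... | inj₁ d≡1  = d≡1
    ... | inj₂ refl = contradiction (∣ᵤ⇒∣ d∣y) p∤y
    abs-square : ∀ w → + w * y * (+ w * y) ≡ + (w ℕ.* ∣ y ∣) * + (w ℕ.* ∣ y ∣)
    abs-square w = begin
      + w * y * (+ w * y)                        ≡⟨ ring (+ w) y ⟩
      + w * + w * (y * y)                        ≡⟨ cong (+ w * + w *_) (square-abs y) ⟩
      + w * + w * + (∣ y ∣ ℕ.* ∣ y ∣)            ≡⟨ cong (+ w * + w *_) (ℤ.pos-* ∣ y ∣ ∣ y ∣) ⟩
      + w * + w * (+ ∣ y ∣ * + ∣ y ∣)            ≡⟨ ring (+ w) (+ ∣ y ∣) ⟨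
      + w * + ∣ y ∣ * (+ w * + ∣ y ∣)            ≡⟨ cong (λ z → z * z) (ℤ.pos-* w ∣ y ∣) ⟨
      + (w ℕ.* ∣ y ∣) * + (w ℕ.* ∣ y ∣)          ∎
      where
      open ≡-Reasoning
      ring : ∀ w y → w * y * (w * y) ≡ w * w * (y * y)
      ring = solve-∀
    from-Bézout : Bézout.Identity 1 p ∣ y ∣ → ∃ λ w → + p ∣ℤ w * y * (w * y) - + 1
    from-Bézout (Bézout.+- a w eq) = + w , divides (+ a * (+ (w ℕ.* ∣ y ∣) - + 1)) (begin
      + w * y * (+ w * y) - + 1          ≡⟨ cong (_- + 1) (abs-square w) ⟩
      z * z - + 1                        ≡⟨ ring z ⟩
      (+ 1 + z) * (z - + 1)              ≡⟨ cong (λ u → + u * (z - + 1)) eq ⟩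
      + (a ℕ.* p) * (z - + 1)            ≡⟨ cong (_* (z - + 1)) (ℤ.pos-* a p) ⟩
      + a * + p * (z - + 1)              ≡⟨ ring′ (+ a) (+ p) (z - + 1) ⟩
      + a * (z - + 1) * + p              ∎)
      where
      open ≡-Reasoning
      z = + (w ℕ.* ∣ y ∣)
      ring : ∀ z → z * z - + 1 ≡ (+ 1 + z) * (z - + 1)
      ring = solve-∀
      ring′ : ∀ a p z → a * p * z ≡ a * z * p
      ring′ = solve-∀
    from-Bézout (Bézout.-+ a w eq) = + w , divides (+ a * (+ 2 + + a * + p)) (begin
      + w * y * (+ w * y) - + 1                        ≡⟨ cong (_- + 1) (abs-square w) ⟩
      + (w ℕ.* ∣ y ∣) * + (w ℕ.* ∣ y ∣) - + 1          ≡⟨ cong (λ u → + u * + u - + 1) eq ⟨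
      (+ 1 + + (a ℕ.* p)) * (+ 1 + + (a ℕ.* p)) - + 1
        ≡⟨ cong (λ u → (+ 1 + u) * (+ 1 + u) - + 1) (ℤ.pos-* a p) ⟩
      (+ 1 + + a * + p) * (+ 1 + + a * + p) - + 1      ≡⟨ ring (+ a) (+ p) ⟩
      + a * (+ 2 + + a * + p) * + p                    ∎)
      where
      open ≡-Reasoning
      ring : ∀ a p → (+ 1 + a * p) * (+ 1 + a * p) - + 1 ≡ a * (+ 2 + a * p) * p
      ring = solve-∀

  -- If p did not divide y, multiplying by the square of an inverse w of ±y would give (xw)² ≡ -1
  -- mod p.
  ∣x²+y²⇒∣x×∣y : p ℕ.% 4 ≡ 3 → ∀ x y → + p ∣ℤ x * x + y * y → + p ∣ℤ x × + p ∣ℤ y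
  ∣x²+y²⇒∣x×∣y p≡3 x y d with + p ∣? y
  ... | yes p∣y = ∣x²⇒∣x x (∣m+n∣n⇒∣m {m = x * x} {n = y * y} d (∣m⇒∣m*n y p∣y)) , p∣y
  ... | no  p∤y = contradiction (subst (p ℕ.∣_) (ℕ.+-comm 1 _) root) (-1-nonresidue p p≡3 ∣ x * w ∣)
    where
    w = proj₁ (inverse-square y p∤y)
    ring : ∀ x y w → w * w * (x * x + y * y) - (w * y * (w * y) - + 1) ≡ + 1 + x * w * (x * w)
    ring = solve-∀
    root : p ℕ.∣ 1 ℕ.+ ∣ x * w ∣ ℕ.* ∣ x * w ∣
    root = ∣⇒∣ᵤ (subst (+ p ∣ℤ_) (trans (ring x y w) (cong (λ z → + 1 + z) (square-abs (x * w))))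
      (∣m∣n⇒∣m-n (∣n⇒∣m*n (w * w) d) (proj₂ (inverse-square y p∤y))))

-- Residues ±1 modulo 8 and division in ℤ[i]

±1-neg : ∀ {x} → Is8m±1 x → Is8m±1 (- x)
±1-neg {x} (m , inj₁ e) = - m , inj₂ (trans (cong -_ e) (ring m))
  where
  ring : ∀ m → - (+ 8 * m + + 1) ≡ + 8 * - m - + 1
  ring = solve-∀
±1-neg {x} (m , inj₂ e) = - m , inj₁ (trans (cong -_ e) (ring m))
  where
  ring : ∀ m → - (+ 8 * m - + 1) ≡ + 8 * - m + + 1
  ring = solve-∀

±1-shift : ∀ {x} q → Is8m±1 x → Is8m±1 (+ 8 * q + x)
±1-shift q (m , inj₁ e) = q + m , inj₁ (trans (cong (λ z → + 8 * q + z) e) (ring q m))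
  where
  ring : ∀ q m → + 8 * q + (+ 8 * m + + 1) ≡ + 8 * (q + m) + + 1
  ring = solve-∀
±1-shift q (m , inj₂ e) = q + m , inj₂ (trans (cong (λ z → + 8 * q + z) e) (ring q m))
  where
  ring : ∀ q m → + 8 * q + (+ 8 * m - + 1) ≡ + 8 * (q + m) - + 1
  ring = solve-∀

-- Modulo 8 the result is ±(a + b) or ±(a - b), according to the signs of x and y. This is what the
-- condition on both a + b and a - b buys: multiplication by a Gaussian factor of a special prime
-- preserves the residues ±1.
±1-combine : ∀ {a b x y} → Is8m±1 (a + b) → Is8m±1 (a - b) → Is8m±1 x → Is8m±1 y → Is8m±1 (a * x + b * y)
±1-combine {a} {b} s d (m , inj₁ refl) (n , inj₁ refl) =
  subst Is8m±1 (ring a b m n) (±1-shift (a * m + b * n) s)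
  where
  ring : ∀ a b m n → + 8 * (a * m + b * n) + (a + b) ≡ a * (+ 8 * m + + 1) + b * (+ 8 * n + + 1)
  ring = solve-∀
±1-combine {a} {b} s d (m , inj₁ refl) (n , inj₂ refl) =
  subst Is8m±1 (ring a b m n) (±1-shift (a * m + b * n) d)
  where
  ring : ∀ a b m n → + 8 * (a * m + b * n) + (a - b) ≡ a * (+ 8 * m + + 1) + b * (+ 8 * n - + 1)
  ring = solve-∀
±1-combine {a} {b} s d (m , inj₂ refl) (n , inj₁ refl) =
  subst Is8m±1 (ring a b m n) (±1-shift (a * m + b * n) (±1-neg d))
  where
  ring : ∀ a b m n → + 8 * (a * m + b * n) + - (a - b) ≡ a * (+ 8 * m - + 1) + b * (+ 8 * n + + 1)
  ring = solve-∀
±1-combine {a} {b} s d (m , inj₂ refl) (n , inj₂ refl) =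
  subst Is8m±1 (ring a b m n) (±1-shift (a * m + b * n) (±1-neg s))
  where
  ring : ∀ a b m n → + 8 * (a * m + b * n) + - (a + b) ≡ a * (+ 8 * m - + 1) + b * (+ 8 * n - + 1)
  ring = solve-∀

±1-* : ∀ {x y} → Is8m±1 x → Is8m±1 y → Is8m±1 (x * y)
±1-* {x} {y} kx ky = subst Is8m±1 (ring x y)
  (±1-combine {x} {+ 0} (subst Is8m±1 (ring₁ x) kx) (subst Is8m±1 (ring₂ x) kx) ky ky)
  where
  ring : ∀ x y → x * y + + 0 * y ≡ x * y
  ring = solve-∀
  ring₁ : ∀ x → x ≡ x + + 0
  ring₁ = solve-∀
  ring₂ : ∀ x → x ≡ x - + 0
  ring₂ = solve-∀

%8≡7⇒±1 : ∀ p → p ℕ.% 8 ≡ 7 → Is8m±1 (+ p)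
%8≡7⇒±1 p e = + (p ℕ./ 8) + + 1 , inj₂ (begin
  + p                                      ≡⟨ cong +_ (ℕ.m≡m%n+[m/n]*n p 8) ⟩
  + (p ℕ.% 8) + + (p ℕ./ 8 ℕ.* 8)          ≡⟨ cong₂ (λ x y → + x + y) e (ℤ.pos-* (p ℕ./ 8) 8) ⟩
  + 7 + + (p ℕ./ 8) * + 8                  ≡⟨ ring (+ (p ℕ./ 8)) ⟩
  + 8 * (+ (p ℕ./ 8) + + 1) - + 1          ∎)
  where
  open ≡-Reasoning
  ring : ∀ q → + 7 + q * + 8 ≡ + 8 * (q + + 1) - + 1
  ring = solve-∀

prime-divisor : ∀ m → m ≢ 1 → .{{ℕ.NonZero m}} → ∃ λ p → Prime p × p ℕ.∣ m
prime-divisor m m≢1 with factorise m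
... | record { factors = List.[] ; isFactorisation = e } = contradiction e m≢1
... | record { factors = p List.∷ _ ; isFactorisation = e ; factorsPrime = pr All.∷ _ } =
  p , pr , subst (p ℕ.∣_) (sym e) (ℕ.m∣m*n _)

-- Stated through prime divisors so that it passes from m to its divisors. A prime 3 mod 4 is either
-- 7 mod 8, with any exponent, or divides m exactly once.
Admissible : ℕ → Set
Admissible m = ∀ p → Prime p → p ℕ.∣ m →
  SpecialPrime p ⊎ (p ℕ.% 4 ≡ 3 × (p ℕ.% 8 ≡ 7 ⊎ ¬ p ℕ.* p ℕ.∣ m))

Admissible-∣ : ∀ {m n} → m ℕ.∣ n → Admissible n → Admissible m
Admissible-∣ m∣n adm p pr p∣m = Sum.map₂
  (λ (p≡3 , c) → p≡3 , Sum.map₂ (λ p²∤n p²∣m → p²∤n (ℕ.∣-trans p²∣m m∣n)) c)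
  (adm p pr (ℕ.∣-trans p∣m m∣n))

-- x + iy = (a + ib)(x′ − iy′) in ℤ[i].
divide-gaussian : ∀ {p} → Prime p → ∀ {a b x y m} → + p ≡ a * a + b * b →
  x * x + y * y ≡ + 2 * (m * + p) → + p ∣ℤ a * x + b * y →
  ∃₂ λ x′ y′ → x ≡ a * x′ + b * y′ × y ≡ b * x′ + - a * y′ × x′ * x′ + y′ * y′ ≡ + 2 * m
divide-gaussian {p} pr {a} {b} {x} {y} {m} norm eq (divides x′ e) = x′ , y′ ,
  cancel x (a * x′ + b * y′) (begin
    P * x                                      ≡⟨ cong (_* x) norm ⟩
    (a * a + b * b) * x                        ≡⟨ ring₁ a b x y ⟩
    a * (a * x + b * y) + b * (b * x - a * y)  ≡⟨ cong₂ (λ u v → a * u + b * v) e f ⟩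
    a * (x′ * P) + b * (y′ * P)                ≡⟨ ring₂ a b x′ y′ P ⟩
    P * (a * x′ + b * y′)                      ∎) ,
  cancel y (b * x′ + - a * y′) (begin
    P * y                                        ≡⟨ cong (_* y) norm ⟩
    (a * a + b * b) * y                          ≡⟨ ring₃ a b x y ⟩
    b * (a * x + b * y) + - a * (b * x - a * y)  ≡⟨ cong₂ (λ u v → b * u + - a * v) e f ⟩
    b * (x′ * P) + - a * (y′ * P)                ≡⟨ ring₂ b (- a) x′ y′ P ⟩
    P * (b * x′ + - a * y′)                      ∎) ,
  cancel (x′ * x′ + y′ * y′) (+ 2 * m) (cancel (P * (x′ * x′ + y′ * y′)) (P * (+ 2 * m)) (begin
    P * (P * (x′ * x′ + y′ * y′))              ≡⟨ ring₄ P x′ y′ ⟩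
    x′ * P * (x′ * P) + y′ * P * (y′ * P)      ≡⟨ cong₂ (λ u v → u * u + v * v) e f ⟨
    u * u + v * v                              ≡⟨ ring₅ a b x y ⟩
    (a * a + b * b) * (x * x + y * y)          ≡⟨ cong₂ _*_ (sym norm) eq ⟩
    P * (+ 2 * (m * P))                        ≡⟨ cong (P *_) (ring₆ m P) ⟩
    P * (P * (+ 2 * m))                        ∎))
  where
  open ≡-Reasoning
  P = + p
  u = a * x + b * y
  v = b * x - a * y
  ring₁ : ∀ a b x y → (a * a + b * b) * x ≡ a * (a * x + b * y) + b * (b * x - a * y)
  ring₁ = solve-∀
  ring₂ : ∀ a b x y p → a * (x * p) + b * (y * p) ≡ p * (a * x + b * y)
  ring₂ = solve-∀
  ring₃ : ∀ a b x y → (a * a + b * b) * y ≡ b * (a * x + b * y) + - a * (b * x - a * y)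
  ring₃ = solve-∀
  ring₄ : ∀ p x y → p * (p * (x * x + y * y)) ≡ x * p * (x * p) + y * p * (y * p)
  ring₄ = solve-∀
  ring₅ : ∀ a b x y → (a * x + b * y) * (a * x + b * y) + (b * x - a * y) * (b * x - a * y) ≡
                      (a * a + b * b) * (x * x + y * y)
  ring₅ = solve-∀
  ring₆ : ∀ m p → + 2 * (m * p) ≡ p * (+ 2 * m)
  ring₆ = solve-∀
  ring₇ : ∀ a b x y → (b * x - a * y) * (b * x - a * y) ≡
          (a * a + b * b) * (x * x + y * y) - (a * x + b * y) * (a * x + b * y)
  ring₇ = solve-∀
  ring₈ : ∀ p x n → p * n - x * p * (x * p) ≡ (n - x * x * p) * p
  ring₈ = solve-∀
  -- Since u² + v² = (a² + b²)(x² + y²) is a multiple of p, and so is u, also p ∣ v².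
  p∣v : P ∣ℤ v
  p∣v = ∣x²⇒∣x pr v (divides (+ 2 * (m * P) - x′ * x′ * P) (trans (ring₇ a b x y)
    (trans (cong₂ (λ s t → s - t * t) (cong₂ _*_ (sym norm) eq) e) (ring₈ P x′ (+ 2 * (m * P))))))
  y′ = p∣v ._∣ℤ_.quotient
  f : v ≡ y′ * P
  f = p∣v ._∣ℤ_.equality
  cancel : ∀ s t → P * s ≡ P * t → s ≡ t
  cancel s t = ℤ.*-cancelˡ-≡ P s t {{prime⇒nonZero pr}}

sum-squares≡2 : ∀ a b → a ℕ.* a ℕ.+ b ℕ.* b ≡ 2 → a ≡ 1 × b ≡ 1
sum-squares≡2 0 0 ()
sum-squares≡2 0 1 ()
sum-squares≡2 0 (suc (suc b)) e = contradiction (ℕ.suc-injective (ℕ.suc-injective e)) (ℕ.m+1+n≢0 b)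
sum-squares≡2 1 1 _ = refl , refl
sum-squares≡2 1 0 ()
sum-squares≡2 1 (suc (suc b)) e = contradiction (ℕ.suc-injective (ℕ.suc-injective e)) λ ()
sum-squares≡2 (suc (suc a)) b e = contradiction (ℕ.suc-injective (ℕ.suc-injective e))
  λ e′ → ℕ.m+1+n≢0 a (ℕ.m+n≡0⇒m≡0 _ e′)

∣x∣≡1⇒±1 : ∀ x → ∣ x ∣ ≡ 1 → Is8m±1 x
∣x∣≡1⇒±1 (+ _)    refl = + 0 , inj₁ refl
∣x∣≡1⇒±1 -[1+ _ ] refl = + 0 , inj₂ refl

%4≢3 : ∀ p → p ≤ 2 → p ℕ.% 4 ≢ 3
%4≢3 0 _ ()
%4≢3 1 _ ()
%4≢3 2 _ ()
%4≢3 (suc (suc (suc p))) (s≤s (s≤s ())) e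

Represented : ℕ → Set
Represented m = .{{ℕ.NonZero m}} → Admissible m → ∀ x y → x * x + y * y ≡ + 2 * + m → Is8m±1 x × Is8m±1 y

-- Each step removes from m one special prime, or the square of a prime 7 mod 8, which divides both
-- x and y. At the end x² + y² = 2, so x and y are ±1.
represented : ∀ m → Represented m
represented = <-rec Represented step
  where
  base : ∀ x y → x * x + y * y ≡ + 2 → Is8m±1 x × Is8m±1 y
  base x y eq = ∣x∣≡1⇒±1 x (proj₁ ones) , ∣x∣≡1⇒±1 y (proj₂ ones)
    where
    ones : ∣ x ∣ ≡ 1 × ∣ y ∣ ≡ 1
    ones = sum-squares≡2 ∣ x ∣ ∣ y ∣ (ℤ.+-injective
      (trans (sym (cong₂ _+_ (square-abs x) (square-abs y))) eq))

  cofactor< : ∀ m m′ p → Prime p → .{{ℕ.NonZero m}} → m ≡ m′ ℕ.* p → m′ < m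
  cofactor< m zero     p pr e = contradiction e (ℕ.≢-nonZero⁻¹ m)
  cofactor< m (suc m′) p pr e = subst (suc m′ <_) (sym e)
    (ℕ.m<m*n (suc m′) p (ℕ.nonTrivial⇒n>1 p {{prime⇒nonTrivial pr}}))

  cofactor≢0 : ∀ m m′ p → .{{ℕ.NonZero m}} → m ≡ m′ ℕ.* p → ℕ.NonZero m′
  cofactor≢0 m zero    p e = contradiction e (ℕ.≢-nonZero⁻¹ m)
  cofactor≢0 m (suc _) p e = _

  special : ∀ m m′ p → .{{ℕ.NonZero m}} → (∀ {k} → k < m → Represented k) → Admissible m →
            m ≡ m′ ℕ.* p → ∀ x y → x * x + y * y ≡ + 2 * + m →
            SpecialPrime p → Is8m±1 x × Is8m±1 y
  special m m′ p rec adm e x y eq (pr , _ , a , b , norm , s , d) =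
    [ conclude b norm s d
    -- Replacing b by -b passes to the conjugate factor of p and exchanges the hypotheses on a + b
    -- and a - b.
    , conclude (- b) (trans norm (ring₁ a b)) d (subst Is8m±1 (ring₂ a b) s)
    ]′ (euclid-ℤ pr (a * x + b * y) (a * x + - b * y) p∣product)
    where
    eq′ : x * x + y * y ≡ + 2 * (+ m′ * + p)
    eq′ = trans eq (cong (+ 2 *_) (trans (cong +_ e) (ℤ.pos-* m′ p)))
    ring₁ : ∀ a b → a * a + b * b ≡ a * a + - b * - b
    ring₁ = solve-∀
    ring₂ : ∀ a b → a + b ≡ a - - b
    ring₂ = solve-∀
    ring₃ : ∀ a b x y → (a * x + b * y) * (a * x + - b * y) ≡ a * a * (x * x + y * y) - y * y * (a * a + b * b)
    ring₃ = solve-∀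
    ring₄ : ∀ a y m p → a * a * (+ 2 * (m * p)) - y * y * p ≡ (a * a * (+ 2 * m) - y * y) * p
    ring₄ = solve-∀
    -- The product is a²(x² + y²) - y²(a² + b²). Which of its factors p divides decides which
    -- conjugate factor of p divides x + iy.
    p∣product : + p ∣ℤ (a * x + b * y) * (a * x + - b * y)
    p∣product = divides (a * a * (+ 2 * + m′) - y * y) (trans (ring₃ a b x y)
      (trans (cong₂ (λ u v → a * a * u - y * y * v) eq′ (sym norm)) (ring₄ a y (+ m′) (+ p))))
    conclude : ∀ b → + p ≡ a * a + b * b → Is8m±1 (a + b) → Is8m±1 (a - b) →
               + p ∣ℤ a * x + b * y → Is8m±1 x × Is8m±1 y
    conclude b norm s d p∣ =
      let x′ , y′ , x≡ , y≡ , eq″ = divide-gaussian pr {a} {b} {x} {y} {+ m′} norm eq′ p∣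
          kx , ky = rec (cofactor< m m′ p pr e) {{cofactor≢0 m m′ p e}}
            (Admissible-∣ (ℕ.divides p (trans e (ℕ.*-comm m′ p))) adm) x′ y′ eq″
      in
      subst Is8m±1 (sym x≡) (±1-combine {a} {b} {x′} {y′} s d kx ky) ,
      subst Is8m±1 (sym y≡) (±1-combine {b} { - a} {x′} {y′} (subst Is8m±1 (ring₅ a b) (±1-neg {a - b} d))
        (subst Is8m±1 (ring₆ a b) s) kx ky)
      where
      ring₅ : ∀ a b → - (a - b) ≡ b + - a
      ring₅ = solve-∀
      ring₆ : ∀ a b → a + b ≡ b - - a
      ring₆ = solve-∀

  inert : ∀ m m′ p → .{{ℕ.NonZero m}} → (∀ {k} → k < m → Represented k) → Admissible m →
          m ≡ m′ ℕ.* p → ∀ x y → x * x + y * y ≡ + 2 * + m → Prime p →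
          p ℕ.% 4 ≡ 3 → p ℕ.% 8 ≡ 7 ⊎ ¬ p ℕ.* p ℕ.∣ m → Is8m±1 x × Is8m±1 y
  inert m m′ p rec adm e x y eq pr p≡3 c = conclude c
    where
    open ≡-Reasoning
    eq′ : x * x + y * y ≡ + 2 * + m′ * + p
    eq′ = trans eq (trans (cong (+ 2 *_) (trans (cong +_ e) (ℤ.pos-* m′ p)))
                          (sym (ℤ.*-assoc (+ 2) (+ m′) (+ p))))
    p∣xy : + p ∣ℤ x × + p ∣ℤ y
    p∣xy = ∣x²+y²⇒∣x×∣y pr p≡3 x y (divides (+ 2 * + m′) eq′)
    x′ = proj₁ p∣xy ._∣ℤ_.quotient
    y′ = proj₂ p∣xy ._∣ℤ_.quotient
    x≡ : x ≡ x′ * + p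
    x≡ = proj₁ p∣xy ._∣ℤ_.equality
    y≡ : y ≡ y′ * + p
    y≡ = proj₂ p∣xy ._∣ℤ_.equality
    ring : ∀ x y p → x * p * (x * p) + y * p * (y * p) ≡ (x * x + y * y) * p * p
    ring = solve-∀
    reduced : (x′ * x′ + y′ * y′) * + p ≡ + 2 * + m′
    reduced = ℤ.*-cancelʳ-≡ ((x′ * x′ + y′ * y′) * + p) (+ 2 * + m′) (+ p) {{prime⇒nonZero pr}}
      (trans (sym (ring x′ y′ (+ p))) (trans (sym (cong₂ (λ u v → u * u + v * v) x≡ y≡)) eq′))
    p∤2 : ¬ p ℕ.∣ 2
    p∤2 p∣2 = %4≢3 p (ℕ.∣⇒≤ p∣2) p≡3
    -- As p² divides x² + y² = 2m′p and p is not 2, it divides m twice. This excludes the primes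
    -- that occur only once.
    p∣m′ : p ℕ.∣ m′
    p∣m′ = [ (λ d → contradiction d p∤2) , id ]′ (euclidsLemma 2 m′ pr
      (subst (p ℕ.∣_) (ℤ.abs-* (+ 2) (+ m′)) (∣⇒∣ᵤ (divides (x′ * x′ + y′ * y′) (sym reduced)))))
    m″ = p∣m′ .ℕ._∣_.quotient
    m′≡ : m′ ≡ m″ ℕ.* p
    m′≡ = p∣m′ .ℕ._∣_.equality
    conclude : p ℕ.% 8 ≡ 7 ⊎ ¬ p ℕ.* p ℕ.∣ m → Is8m±1 x × Is8m±1 y
    conclude (inj₂ p²∤m) = contradiction
      (subst (p ℕ.* p ℕ.∣_) (sym e) (ℕ.*-monoˡ-∣ p p∣m′)) p²∤m
    conclude (inj₁ p≡7) =
      subst Is8m±1 (sym x≡) (±1-* {x′} {+ p} (proj₁ ih) (%8≡7⇒±1 p p≡7)) ,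
      subst Is8m±1 (sym y≡) (±1-* {y′} {+ p} (proj₂ ih) (%8≡7⇒±1 p p≡7))
      where
      instance
        m′≢0 : ℕ.NonZero m′
        m′≢0 = cofactor≢0 m m′ p e
      eq″ : x′ * x′ + y′ * y′ ≡ + 2 * + m″
      eq″ = ℤ.*-cancelʳ-≡ (x′ * x′ + y′ * y′) (+ 2 * + m″) (+ p) {{prime⇒nonZero pr}} (begin
        (x′ * x′ + y′ * y′) * + p  ≡⟨ reduced ⟩
        + 2 * + m′                 ≡⟨ cong (+ 2 *_) (trans (cong +_ m′≡) (ℤ.pos-* m″ p)) ⟩
        + 2 * (+ m″ * + p)         ≡⟨ ℤ.*-assoc (+ 2) (+ m″) (+ p) ⟨
        + 2 * + m″ * + p           ∎)
      ih : Is8m±1 x′ × Is8m±1 y′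
      ih = rec (ℕ.<-trans (cofactor< m′ m″ p pr m′≡) (cofactor< m m′ p pr e)) {{cofactor≢0 m′ m″ p m′≡}}
             (Admissible-∣ (ℕ.∣-trans (ℕ.divides p (trans m′≡ (ℕ.*-comm m″ p)))
               (ℕ.divides p (trans e (ℕ.*-comm m′ p)))) adm) x′ y′ eq″

  step : ∀ m → (∀ {k} → k < m → Represented k) → Represented m
  step m rec adm x y eq with m ℕ.≟ 1
  ... | yes refl = base x y eq
  ... | no m≢1 with prime-divisor m m≢1
  ...   | p , pr , p∣m@(ℕ.divides m′ e) =
    [ special m m′ p rec adm e x y eq
    , (λ (p≡3 , c) → inert m m′ p rec adm e x y eq pr p≡3 c)
    ]′ (adm p pr p∣m)

-- Congruences

infix 4 _≈_[_] _≈?_[_]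
-- The quotient is kept as data: matching the equation with `refl` turns a rule for congruences into
-- a ring identity.
record _≈_[_] (x y : ℤ) (n : ℕ) : Set where
  constructor by
  field
    quotient : ℤ
    equality : x ≡ y + quotient * + n

module _ {n : ℕ} where
  ≈-refl : ∀ {x} → x ≈ x [ n ]
  ≈-refl {x} = by (+ 0) (ring x (+ n))
    where
    ring : ∀ x n → x ≡ x + + 0 * n
    ring = solve-∀

  ≈-sym : ∀ {x y} → x ≈ y [ n ] → y ≈ x [ n ]
  ≈-sym {x} {y} (by q e) = by (- q) (trans (ring y q (+ n)) (cong (λ z → z + - q * + n) (sym e)))
    where
    ring : ∀ y q n → y ≡ y + q * n + - q * n
    ring = solve-∀

  ≈-trans : ∀ {x y z} → x ≈ y [ n ] → y ≈ z [ n ] → x ≈ z [ n ]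
  ≈-trans {x} {y} {z} (by q refl) (by r refl) = by (q + r) (ring z q r (+ n))
    where
    ring : ∀ z q r n → z + r * n + q * n ≡ z + (q + r) * n
    ring = solve-∀

  ≈-+ : ∀ {x y z w} → x ≈ y [ n ] → z ≈ w [ n ] → x + z ≈ y + w [ n ]
  ≈-+ {x} {y} {z} {w} (by q refl) (by r refl) = by (q + r) (ring y w q r (+ n))
    where
    ring : ∀ y w q r n → y + q * n + (w + r * n) ≡ y + w + (q + r) * n
    ring = solve-∀

  ≈-neg : ∀ {x y} → x ≈ y [ n ] → - x ≈ - y [ n ]
  ≈-neg {x} {y} (by q refl) = by (- q) (ring y q (+ n))
    where
    ring : ∀ y q n → - (y + q * n) ≡ - y + - q * n
    ring = solve-∀

  ≈-- : ∀ {x y z w} → x ≈ y [ n ] → z ≈ w [ n ] → x - z ≈ y - w [ n ]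
  ≈-- p q = ≈-+ p (≈-neg q)

  ≈-* : ∀ {x y z w} → x ≈ y [ n ] → z ≈ w [ n ] → x * z ≈ y * w [ n ]
  ≈-* {x} {y} {z} {w} (by q refl) (by r refl) = by (q * w + y * r + q * r * + n) (ring y w q r (+ n))
    where
    ring : ∀ y w q r n → (y + q * n) * (w + r * n) ≡ y * w + (q * w + y * r + q * r * n) * n
    ring = solve-∀

  ≈-reflexive : ∀ {x y} → x ≡ y → x ≈ y [ n ]
  ≈-reflexive refl = ≈-refl

-- From (y + 2kq)² = y² + 4k(qy + kq²): the modulus doubles. Together with `≈-double` this makes
-- `re` modulo 8 depend on d modulo 4 and `descend` modulo 4 on c modulo 2, so 256 cases suffice for
-- each check below.
≈-square : ∀ k {x y} → x ≈ y [ 2 ℕ.* k ] → x * x ≈ y * y [ 2 ℕ.* (2 ℕ.* k) ]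
≈-square k {x} {y} (by q refl) = by (q * y + q * q * + k)
  (subst₂ (λ n m → (y + q * n) * (y + q * n) ≡ y * y + (q * y + q * q * + k) * m)
    (sym (ℤ.pos-* 2 k)) (sym (trans (ℤ.pos-* 2 (2 ℕ.* k)) (cong (+ 2 *_) (ℤ.pos-* 2 k)))) (ring y q (+ k)))
  where
  ring : ∀ y q k → (y + q * (+ 2 * k)) * (y + q * (+ 2 * k)) ≡ y * y + (q * y + q * q * k) * (+ 2 * (+ 2 * k))
  ring = solve-∀

≈-double : ∀ n {x y} → x ≈ y [ n ] → + 2 * x ≈ + 2 * y [ 2 ℕ.* n ]
≈-double n {x} {y} (by q refl) = by q
  (subst (λ m → + 2 * (y + q * + n) ≡ + 2 * y + q * m) (sym (ℤ.pos-* 2 n)) (ring y q (+ n)))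
  where
  ring : ∀ y q n → + 2 * (y + q * n) ≡ + 2 * y + q * (+ 2 * n)
  ring = solve-∀

≈-coarsen : ∀ k n {x y} → x ≈ y [ k ℕ.* n ] → x ≈ y [ n ]
≈-coarsen k n {x} {y} (by q refl) = by (q * + k)
  (cong (λ z → y + z) (trans (cong (q *_) (ℤ.pos-* k n)) (sym (ℤ.*-assoc q (+ k) (+ n)))))

_≈?_[_] : ∀ x y n → Dec (x ≈ y [ n ])
x ≈? y [ n ] = map′ (λ (divides q e) → by q (trans (ring x y) (cong (λ z → y + z) e)))
                    (λ (by q e) → divides q (trans (cong (_- y) e) (ring′ y (q * + n))))
                    (+ n ∣? x - y)
  where
  ring : ∀ x y → x ≡ y + (x - y)
  ring = solve-∀
  ring′ : ∀ y z → y + z - y ≡ z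
  ring′ = solve-∀

-- A vector of residues is coded as one number below mⁿ, so that a single `Fin.all?` decides a
-- statement about all of them.
residue-vector : ∀ {m n} → Fin (m ℕ.^ n) → Fin n → ℤ
residue-vector t i = + toℕ (finToFun t i)

residues : ∀ m .{{_ : ℕ.NonZero m}} {n} (c : Fin n → ℤ) →
           ∃ λ (t : Fin (m ℕ.^ n)) → ∀ i → c i ≈ residue-vector t i [ m ]
residues m {n} c = funToFin r , λ i →
  subst (λ j → c i ≈ + toℕ j [ m ]) (sym (Fin.finToFun-funToFin r i)) (by (c i /ℕ m)
    (trans (ℤ.a≡a%ℕn+[a/ℕn]*n (c i) m) (cong (λ k → + k + c i /ℕ m * + m)
      (sym (Fin.toℕ-fromℕ< (ℤ.n%ℕd<d (c i) m))))))
  where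
  r : Fin n → Fin m
  r i = fromℕ< (ℤ.n%ℕd<d (c i) m)

-- The contradiction modulo powers of 2

Odd : ℤ → Set
Odd x = x ≈ + 1 [ 2 ]

Odd? : ∀ x → Dec (Odd x)
Odd? x = x ≈? + 1 [ 2 ]

±1-mod8 : ℤ → Set
±1-mod8 x = x ≈ + 1 [ 8 ] ⊎ x ≈ - + 1 [ 8 ]

re-≈ : ∀ {d d′} → (∀ i → d i ≈ d′ i [ 4 ]) → re d ≈ re d′ [ 8 ]
re-≈ e = ≈-+ (≈-- (≈-square 2 (e 0F)) (≈-square 2 (e 2F))) (≈-double 4 (≈-* (e 1F) (e 3F)))

-- One of d₀, d₂ is even, and one of d₁, d₃. Modulo 8, re d is ±1, plus 4 for each of these even
-- entries that is 2 mod 4. It is ±1 again only if both or neither contribute, and d₀d₂ and d₁d₃ are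
-- 2 or 0 mod 4 accordingly.
re±1⇒balanced : ∀ d → Odd (d 0F - d 2F) → Odd (d 1F - d 3F) → ±1-mod8 (re d) →
                d 0F * d 2F ≈ d 1F * d 3F [ 4 ]
re±1⇒balanced d o₀ o₁ h = ≈-trans (≈-* (e 0F) (e 2F)) (≈-trans
  (check t (transfer 0F 2F o₀) (transfer 1F 3F o₁)
    (Sum.map (≈-trans (≈-sym (re-≈ e))) (≈-trans (≈-sym (re-≈ e))) h))
  (≈-sym (≈-* (e 1F) (e 3F))))
  where
  t = proj₁ (residues 4 d)
  e : ∀ i → d i ≈ residue-vector t i [ 4 ]
  e = proj₂ (residues 4 d)
  transfer : ∀ i j → Odd (d i - d j) → Odd (residue-vector t i - residue-vector t j)
  transfer i j o = ≈-trans (≈-sym (≈-coarsen 2 2 (≈-- (e i) (e j)))) o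
  check : ∀ t → let r = residue-vector {4} {4} t in
          Odd (r 0F - r 2F) → Odd (r 1F - r 3F) → ±1-mod8 (re r) → r 0F * r 2F ≈ r 1F * r 3F [ 4 ]
  check = from-yes (Fin.all? λ t → let r = residue-vector {4} {4} t in
    Odd? (r 0F - r 2F) →-dec Odd? (r 1F - r 3F) →-dec
    ((re r ≈? + 1 [ 8 ]) ⊎-dec (re r ≈? - + 1 [ 8 ])) →-dec
    (r 0F * r 2F ≈? r 1F * r 3F [ 4 ]))

descend-≈ : ∀ {c c′} → (∀ i → c i ≈ c′ i [ 2 ]) → ∀ i → descend c i ≈ descend c′ i [ 4 ]
descend-≈ e 0F = ≈-+ (≈-- (≈-square 1 (e 0F)) (≈-square 1 (e 4F)))
  (≈-double 2 (≈-- (≈-+ (≈-* (e 1F) (e 7F)) (≈-* (e 3F) (e 5F))) (≈-* (e 2F) (e 6F))))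
descend-≈ e 1F = ≈-+ (≈-- (≈-square 1 (e 5F)) (≈-square 1 (e 1F)))
  (≈-double 2 (≈-+ (≈-- (≈-* (e 0F) (e 2F)) (≈-* (e 4F) (e 6F))) (≈-* (e 3F) (e 7F))))
descend-≈ e 2F = ≈-+ (≈-- (≈-square 1 (e 2F)) (≈-square 1 (e 6F)))
  (≈-double 2 (≈-+ (≈-- (≈-* (e 0F) (e 4F)) (≈-* (e 1F) (e 3F))) (≈-* (e 5F) (e 7F))))
descend-≈ e 3F = ≈-+ (≈-- (≈-square 1 (e 7F)) (≈-square 1 (e 3F)))
  (≈-double 2 (≈-- (≈-+ (≈-* (e 0F) (e 6F)) (≈-* (e 2F) (e 4F))) (≈-* (e 1F) (e 5F))))

-- Taken modulo 2, half of (s₀s₂ - s₁s₃) - (d₀d₂ - d₁d₃), where s and d are the remainders modulo x⁴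
-- - 1 and x⁴ + 1; differences are written as sums since only the parity matters.
cross : (Fin 8 → ℤ) → ℤ
cross c = c 4F * (c 2F + c 6F) + c 6F * (c 0F + c 4F) - (c 5F * (c 3F + c 7F) + c 7F * (c 1F + c 5F))

cross-≈ : ∀ {c c′} → (∀ i → c i ≈ c′ i [ 2 ]) → cross c ≈ cross c′ [ 2 ]
cross-≈ e = ≈-- (≈-+ (≈-* (e 4F) (≈-+ (e 2F) (e 6F))) (≈-* (e 6F) (≈-+ (e 0F) (e 4F))))
                (≈-+ (≈-* (e 5F) (≈-+ (e 3F) (e 7F))) (≈-* (e 7F) (≈-+ (e 1F) (e 5F))))

evens odds : (Fin 8 → ℤ) → ℤ
evens c = c 0F - c 4F - (c 2F - c 6F)
odds  c = c 1F - c 5F - (c 3F - c 7F)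

-- All hypotheses depend only on c modulo 2, and the 256 vectors are checked. The conclusion says
-- that `cross c` is even, in the form in which X ≡ 2 mod 4 will contradict it.
balanced⇒cross-even : ∀ c → Odd (evens c) → Odd (odds c) →
  descend c 0F * descend c 2F ≈ descend c 1F * descend c 3F [ 4 ] → ¬ + 2 * cross c ≈ + 2 [ 4 ]
balanced⇒cross-even c o₀ o₁ h k = check t
  (≈-trans (≈-sym (≈-- (≈-- (e 0F) (e 4F)) (≈-- (e 2F) (e 6F)))) o₀)
  (≈-trans (≈-sym (≈-- (≈-- (e 1F) (e 5F)) (≈-- (e 3F) (e 7F)))) o₁)
  (≈-trans (≈-sym (≈-* (descend-≈ e 0F) (descend-≈ e 2F)))
    (≈-trans h (≈-* (descend-≈ e 1F) (descend-≈ e 3F))))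
  (≈-trans (≈-sym (≈-double 2 (cross-≈ e))) k)
  where
  t = proj₁ (residues 2 c)
  e : ∀ i → c i ≈ residue-vector t i [ 2 ]
  e = proj₂ (residues 2 c)
  check : ∀ t → let r = residue-vector {2} {8} t in Odd (evens r) → Odd (odds r) →
          descend r 0F * descend r 2F ≈ descend r 1F * descend r 3F [ 4 ] → ¬ + 2 * cross r ≈ + 2 [ 4 ]
  check = from-yes (Fin.all? λ t → let r = residue-vector {2} {8} t in
    Odd? (evens r) →-dec Odd? (odds r) →-dec
    (descend r 0F * descend r 2F ≈? descend r 1F * descend r 3F [ 4 ]) →-dec
    ¬? (+ 2 * cross r ≈? + 2 [ 4 ]))

cancel-odd : ∀ x m → Odd m → x * m ≈ + 2 [ 4 ] → x ≈ + 2 [ 4 ]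
cancel-odd x m o h = ≈-trans (e 0F) (check t
  (≈-trans (≈-sym (≈-coarsen 2 2 (e 1F))) o) (≈-trans (≈-sym (≈-* (e 0F) (e 1F))) h))
  where
  v : Fin 2 → ℤ
  v 0F = x
  v 1F = m
  t = proj₁ (residues 4 v)
  e : ∀ i → v i ≈ residue-vector t i [ 4 ]
  e = proj₂ (residues 4 v)
  check : ∀ t → let r = residue-vector {4} {2} t in
          Odd (r 1F) → r 0F * r 1F ≈ + 2 [ 4 ] → r 0F ≈ + 2 [ 4 ]
  check = from-yes (Fin.all? λ t → let r = residue-vector {4} {2} t in
    Odd? (r 1F) →-dec (r 0F * r 1F ≈? + 2 [ 4 ]) →-dec (r 0F ≈? + 2 [ 4 ]))

Even : ℤ → Set
Even x = x ≈ + 0 [ 2 ]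

even-or-odd : ∀ x → Even x ⊎ Odd x
even-or-odd x = classify (x %ℕ 2) (ℤ.n%ℕd<d x 2) (by (x /ℕ 2) (ℤ.a≡a%ℕn+[a/ℕn]*n x 2))
  where
  classify : ∀ r → r ℕ.< 2 → x ≈ + r [ 2 ] → Even x ⊎ Odd x
  classify 0 _ e = inj₁ e
  classify 1 _ e = inj₂ e
  classify (suc (suc r)) (ℕ.s≤s (ℕ.s≤s ())) _

even×odd⇒⊥ : ∀ {x} → Even x → Odd x → ⊥
even×odd⇒⊥ e o = from-no (+ 0 ≈? + 1 [ 2 ]) (≈-trans (≈-sym e) o)

multiple-even : ∀ x → Even (+ 2 * x)
multiple-even x = by x (ring x)
  where
  ring : ∀ x → + 2 * x ≡ + 0 + x * + 2
  ring = solve-∀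

square≈self : ∀ x → x * x ≈ x [ 2 ]
square≈self x = [ (λ e → ≈-trans (≈-* e e) (≈-sym e)) , (λ o → ≈-trans (≈-* o o) (≈-sym o)) ]′
  (even-or-odd x)

minus≈plus : ∀ x y → x - y ≈ x + y [ 2 ]
minus≈plus x y = by (- y) (ring x y)
  where
  ring : ∀ x y → x - y ≡ x + y + - y * + 2
  ring = solve-∀

minus≈swap : ∀ x y → x - y ≈ y - x [ 2 ]
minus≈swap x y = by (x - y) (ring x y)
  where
  ring : ∀ x y → x - y ≡ y - x + (x - y) * + 2
  ring = solve-∀

sum-squares-half : ∀ {x y} → Odd x → Odd y → ∃ λ m → Odd m × x * x + y * y ≡ + 2 * m
sum-squares-half (by q refl) (by r refl) =
  + 1 + (q + q * q + r + r * r) * + 2 , by (q + q * q + r + r * r) refl , ring q r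
  where
  ring : ∀ q r → (+ 1 + q * + 2) * (+ 1 + q * + 2) + (+ 1 + r * + 2) * (+ 1 + r * + 2) ≡
                 + 2 * (+ 1 + (q + q * q + r + r * r) * + 2)
  ring = solve-∀

module _ {u v : ℤ} where
  -- The four factors have the parity of u + v, and are all divisible by 4 if u and v are even.
  odd-pair : ∀ {p₀ q₀ p₁ q₁ p₂ q₂ P} →
    p₀ ≈ u [ 2 ] → q₀ ≈ v [ 2 ] → p₁ ≈ u [ 2 ] → q₁ ≈ v [ 2 ] → p₂ ≈ u [ 2 ] → q₂ ≈ v [ 2 ] →
    Odd P →
    (p₀ * p₀ - q₀ * q₀) * sumSquares u v * sumSquares p₁ q₁ * sumSquares p₂ q₂ ≡ + 64 * P →
    Odd u × Odd v
  odd-pair {p₀} {q₀} {p₁} {q₁} {p₂} {q₂} {P} a₀ b₀ a₁ b₁ a₂ b₂ oddP eq =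
    cases (even-or-odd u) (even-or-odd v)
    where
    ring₁ : ∀ P → + 64 * P ≡ + 2 * (+ 32 * P)
    ring₁ = solve-∀
    left-even : Even (+ 64 * P)
    left-even = ≈-trans (≈-reflexive (ring₁ P)) (multiple-even (+ 32 * P))
    -- Four multiples of 4 would make 64P a multiple of 256, hence P even.
    all-even : Even u → Even v → ⊥
    all-even eu ev = finish (≈-- (sq (≈-trans a₀ eu)) (sq (≈-trans b₀ ev))) (≈-+ (sq eu) (sq ev))
      (≈-+ (sq (≈-trans a₁ eu)) (sq (≈-trans b₁ ev))) (≈-+ (sq (≈-trans a₂ eu)) (sq (≈-trans b₂ ev)))
      where
      sq : ∀ {x} → Even x → x * x ≈ + 0 [ 4 ]
      sq = ≈-square 1
      ring : ∀ a b c d → (+ 0 + a * + 4) * (+ 0 + b * + 4) * (+ 0 + c * + 4) * (+ 0 + d * + 4) ≡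
             + 64 * (+ 2 * (+ 2 * (a * b * c * d)))
      ring = solve-∀
      finish : p₀ * p₀ - q₀ * q₀ ≈ + 0 [ 4 ] → sumSquares u v ≈ + 0 [ 4 ] →
               sumSquares p₁ q₁ ≈ + 0 [ 4 ] → sumSquares p₂ q₂ ≈ + 0 [ 4 ] → ⊥
      finish (by a e₀) (by b e₁) (by c e₂) (by d e₃) = even×odd⇒⊥
        (≈-trans (≈-reflexive (ℤ.*-cancelˡ-≡ (+ 64) P (+ 2 * (+ 2 * (a * b * c * d))) (trans (sym eq)
          (trans (cong₂ _*_ (cong₂ _*_ (cong₂ _*_ e₀ e₁) e₂) e₃) (ring a b c d)))))
          (multiple-even (+ 2 * (a * b * c * d)))) oddP
    product-odd : Odd (p₀ * p₀ - q₀ * q₀) → Odd (sumSquares u v) →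
                  Odd (sumSquares p₁ q₁) → Odd (sumSquares p₂ q₂) → ⊥
    product-odd o₀ o₁ o₂ o₃ = even×odd⇒⊥ left-even
      (≈-trans (≈-reflexive (sym eq)) (≈-* (≈-* (≈-* o₀ o₁) o₂) o₃))
    mixed : ∀ {k l} → u ≈ k [ 2 ] → v ≈ l [ 2 ] → Odd (k * k - l * l) → Odd (k * k + l * l) → ⊥
    mixed eu ev o o′ = product-odd
      (≈-trans (≈-- (≈-* (≈-trans a₀ eu) (≈-trans a₀ eu)) (≈-* (≈-trans b₀ ev) (≈-trans b₀ ev))) o)
      (≈-trans (≈-+ (≈-* eu eu) (≈-* ev ev)) o′)
      (≈-trans (≈-+ (≈-* (≈-trans a₁ eu) (≈-trans a₁ eu)) (≈-* (≈-trans b₁ ev) (≈-trans b₁ ev))) o′)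
      (≈-trans (≈-+ (≈-* (≈-trans a₂ eu) (≈-trans a₂ eu)) (≈-* (≈-trans b₂ ev) (≈-trans b₂ ev))) o′)
    cases : Even u ⊎ Odd u → Even v ⊎ Odd v → Odd u × Odd v
    cases (inj₂ ou) (inj₂ ov) = ou , ov
    cases (inj₁ eu) (inj₁ ev) = contradiction ev (all-even eu)
    cases (inj₁ eu) (inj₂ ov) = contradiction
      (mixed eu ov (by (- + 1) refl) (by (+ 0) refl)) id
    cases (inj₂ ou) (inj₁ ev) = contradiction
      (mixed ou ev (by (+ 0) refl) (by (+ 0) refl)) id

±1-square : ∀ {x} → ±1-mod8 x → x * x ≈ + 1 [ 16 ]
±1-square (inj₁ e) = ≈-square 4 e
±1-square (inj₂ e) = ≈-square 4 e

-- The only information about the prime factors of N that enters the congruence argument.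
Conclusive : ℤ → Set
Conclusive N = ∀ x y m → Odd m → (∃ λ n → N ≡ n * m) → x * x + y * y ≡ + 2 * m → ±1-mod8 x × ±1-mod8 y

re≈ : ∀ d → re d ≈ d 0F - d 2F [ 2 ]
re≈ d = ≈-trans
  (≈-+ (≈-- (square≈self (d 0F)) (square≈self (d 2F))) (multiple-even (d 1F * d 3F)))
  (≈-reflexive (ℤ.+-identityʳ (d 0F - d 2F)))

im≈ : ∀ d → im d ≈ d 1F - d 3F [ 2 ]
im≈ d = ≈-trans
  (≈-+ (≈-- (square≈self (d 3F)) (square≈self (d 1F))) (multiple-even (d 0F * d 2F)))
  (≈-trans (≈-reflexive (ℤ.+-identityʳ (d 3F - d 1F))) (minus≈swap (d 3F) (d 1F)))

descend≈ : ∀ x y z → x * x - y * y + + 2 * z ≈ x - y [ 2 ]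
descend≈ x y z = ≈-trans (≈-+ (≈-- (square≈self x) (square≈self y)) (multiple-even z))
  (≈-reflexive (ℤ.+-identityʳ (x - y)))

descend-evens : ∀ c → descend c 0F - descend c 2F ≈ evens c [ 2 ]
descend-evens c = ≈-- (descend≈ (c 0F) (c 4F) (c 1F * c 7F + c 3F * c 5F - c 2F * c 6F))
                      (descend≈ (c 2F) (c 6F) (c 0F * c 4F - c 1F * c 3F + c 5F * c 7F))

descend-odds : ∀ c → descend c 1F - descend c 3F ≈ odds c [ 2 ]
descend-odds c = ≈-- (≈-trans (descend≈ (c 5F) (c 1F) (c 0F * c 2F - c 4F * c 6F + c 3F * c 7F))
                              (minus≈swap (c 5F) (c 1F)))
                     (≈-trans (descend≈ (c 7F) (c 3F) (c 0F * c 6F + c 2F * c 4F - c 1F * c 5F))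
                              (minus≈swap (c 7F) (c 3F)))

-- n₁n₂ = u² − v² + 4X with u² ≡ v² mod 16, so that n₁n₂ = 8 · odd forces X ≡ 2 mod 4.
rational-twice-odd : ∀ {s m₁ m₂ m₃ P} → Odd m₁ → Odd m₂ → Odd m₃ → Odd P →
  (s 0F - s 2F) * (s 0F - s 2F) ≈ + 1 [ 16 ] → (s 1F - s 3F) * (s 1F - s 3F) ≈ + 1 [ 16 ] →
  rational s * (+ 2 * m₁) * (+ 2 * m₂) * (+ 2 * m₃) ≡ + 64 * P →
  s 0F * s 2F - s 1F * s 3F ≈ + 2 [ 4 ]
rational-twice-odd {s} {m₁} {m₂} {m₃} {P} o₁ o₂ o₃ oP (by α eα) (by β eβ) eq =
  cancel-odd X (m₁ * m₂ * m₃) (≈-* (≈-* o₁ o₂) o₃) (≈-trans (by (- (w * M)) X*M) (≈-double 2 oP))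
  where
  open ≡-Reasoning
  X = s 0F * s 2F - s 1F * s 3F
  M = m₁ * m₂ * m₃
  w = α - β
  ring₁ : ∀ a b c d → (a + c) * (a + c) - (b + d) * (b + d) ≡
          (a - c) * (a - c) - (b - d) * (b - d) + + 4 * (a * c - b * d)
  ring₁ = solve-∀
  ring₂ : ∀ α β X → + 1 + α * + 16 - (+ 1 + β * + 16) + + 4 * X ≡ + 4 * (+ 4 * (α - β) + X)
  ring₂ = solve-∀
  ring₃ : ∀ Y a b c → + 32 * (Y * (a * b * c)) ≡ + 4 * Y * (+ 2 * a) * (+ 2 * b) * (+ 2 * c)
  ring₃ = solve-∀
  ring₄ : ∀ P → + 64 * P ≡ + 32 * (+ 2 * P)
  ring₄ = solve-∀
  ring₅ : ∀ w X M → X * M ≡ (+ 4 * w + X) * M + - (w * M) * + 4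
  ring₅ = solve-∀
  rational≡ : rational s ≡ + 4 * (+ 4 * w + X)
  rational≡ = trans (ring₁ (s 0F) (s 1F) (s 2F) (s 3F))
    (trans (cong₂ (λ x y → x - y + + 4 * X) eα eβ) (ring₂ α β X))
  product≡ : (+ 4 * w + X) * M ≡ + 2 * P
  product≡ = ℤ.*-cancelˡ-≡ (+ 32) ((+ 4 * w + X) * M) (+ 2 * P) (begin
    + 32 * ((+ 4 * w + X) * M)
      ≡⟨ ring₃ (+ 4 * w + X) m₁ m₂ m₃ ⟩
    + 4 * (+ 4 * w + X) * (+ 2 * m₁) * (+ 2 * m₂) * (+ 2 * m₃)
      ≡⟨ cong (λ r → r * (+ 2 * m₁) * (+ 2 * m₂) * (+ 2 * m₃)) rational≡ ⟨
    rational s * (+ 2 * m₁) * (+ 2 * m₂) * (+ 2 * m₃)  ≡⟨ eq ⟩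
    + 64 * P                                           ≡⟨ ring₄ P ⟩
    + 32 * (+ 2 * P)                                   ∎)
  X*M : X * M ≡ + 2 * P + - (w * M) * + 4
  X*M = trans (ring₅ w X M) (cong (λ z → z + - (w * M) * + 4) product≡)

-- Here b and c stand for f modulo x⁸ - 1 and x⁸ + 1. Their congruence modulo 2 is the one link
-- between the norm at ζ₁₆ and the other factors.
module _ (b c : Fin 8 → ℤ) (c≈b : ∀ i → c i ≈ b i [ 2 ]) where
  s d : Fin 4 → ℤ
  s = plus 4 b
  d = minus 4 b
  G : Fin 4 → ℤ
  G = descend c
  u v X : ℤ
  u = s 0F - s 2F
  v = s 1F - s 3F
  X = s 0F * s 2F - s 1F * s 3F

  d-even : d 0F - d 2F ≈ u [ 2 ]
  d-even = ≈-- (minus≈plus (b 0F) (b 4F)) (minus≈plus (b 2F) (b 6F))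

  d-odd : d 1F - d 3F ≈ v [ 2 ]
  d-odd = ≈-- (minus≈plus (b 1F) (b 5F)) (minus≈plus (b 3F) (b 7F))

  c-even : evens c ≈ u [ 2 ]
  c-even = ≈-trans (≈-- (≈-- (c≈b 0F) (c≈b 4F)) (≈-- (c≈b 2F) (c≈b 6F))) d-even

  c-odd : odds c ≈ v [ 2 ]
  c-odd = ≈-trans (≈-- (≈-- (c≈b 1F) (c≈b 5F)) (≈-- (c≈b 3F) (c≈b 7F))) d-odd

  -- Substituting sᵢ = dᵢ + 2bᵢ₊₄ in X gives d₀d₂ - d₁d₃, which the hypothesis removes, plus 2 ·
  -- `cross` modulo 4.
  X≈cross : d 0F * d 2F ≈ d 1F * d 3F [ 4 ] → X ≈ + 2 * cross c [ 4 ]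
  X≈cross h = ≈-trans (≈-trans (by (b 4F * b 6F - b 5F * b 7F)
      (ring (b 0F) (b 1F) (b 2F) (b 3F) (b 4F) (b 5F) (b 6F) (b 7F)))
    (≈-+ (≈-- h (≈-refl {4} {d 1F * d 3F})) (≈-double 2 Y≈cross)))
    (≈-reflexive (ring′ (d 1F * d 3F) (+ 2 * cross c)))
    where
    ring : ∀ b₀ b₁ b₂ b₃ b₄ b₅ b₆ b₇ →
      (b₀ + b₄) * (b₂ + b₆) - (b₁ + b₅) * (b₃ + b₇) ≡
      (b₀ - b₄) * (b₂ - b₆) - (b₁ - b₅) * (b₃ - b₇) +
      + 2 * (b₄ * (b₂ - b₆) + b₆ * (b₀ - b₄) - (b₅ * (b₃ - b₇) + b₇ * (b₁ - b₅))) +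
      (b₄ * b₆ - b₅ * b₇) * + 4
    ring = solve-∀
    ring′ : ∀ x y → x - x + y ≡ y
    ring′ = solve-∀
    pair : ∀ i j → b i - b j ≈ c i + c j [ 2 ]
    pair i j = ≈-trans (minus≈plus (b i) (b j)) (≈-sym (≈-+ (c≈b i) (c≈b j)))
    Y≈cross : b 4F * (b 2F - b 6F) + b 6F * (b 0F - b 4F) - (b 5F * (b 3F - b 7F) + b 7F * (b 1F - b 5F))
              ≈ cross c [ 2 ]
    Y≈cross = ≈-- (≈-+ (≈-* (≈-sym (c≈b 4F)) (pair 2F 6F)) (≈-* (≈-sym (c≈b 6F)) (pair 0F 4F)))
                  (≈-+ (≈-* (≈-sym (c≈b 5F)) (pair 3F 7F)) (≈-* (≈-sym (c≈b 7F)) (pair 1F 5F)))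

  -- The factors at ±1, i and ζ₈ give 2 · `cross c` ≡ X ≡ 2 mod 4, and the factor at ζ₁₆ forbids it.
  impossible : ∀ P → Odd P → Conclusive (+ 64 * P) →
    rational s * sumSquares u v * sumSquares (re d) (im d) * sumSquares (re G) (im G) ≢ + 64 * P
  impossible P oP conclusive eq = balanced⇒cross-even c (≈-trans c-even ou) (≈-trans c-odd ov)
    (re±1⇒balanced G (≈-trans (≈-trans (descend-evens c) c-even) ou)
                     (≈-trans (≈-trans (descend-odds c) c-odd) ov) (proj₁ k₃))
    (≈-trans (≈-sym (X≈cross
        (re±1⇒balanced d (≈-trans d-even ou) (≈-trans d-odd ov) (proj₁ k₂))))
      (rational-twice-odd {s} {m₁} {m₂} {m₃} {P} o₁ o₂ o₃ oP
        (±1-square (proj₁ k₁)) (±1-square (proj₂ k₁)) eq′))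
    where
    R = rational s
    re-d : re d ≈ u [ 2 ]
    re-d = ≈-trans (re≈ d) d-even
    im-d : im d ≈ v [ 2 ]
    im-d = ≈-trans (im≈ d) d-odd
    re-G : re G ≈ u [ 2 ]
    re-G = ≈-trans (re≈ G) (≈-trans (descend-evens c) c-even)
    im-G : im G ≈ v [ 2 ]
    im-G = ≈-trans (im≈ G) (≈-trans (descend-odds c) c-odd)
    odd-uv : Odd u × Odd v
    odd-uv = odd-pair {u} {v} (≈-sym (minus≈plus (s 0F) (s 2F))) (≈-sym (minus≈plus (s 1F) (s 3F)))
      re-d im-d re-G im-G oP eq
    ou = proj₁ odd-uv
    ov = proj₂ odd-uv
    half₁ : ∃ λ m → Odd m × sumSquares u v ≡ + 2 * m
    half₁ = sum-squares-half ou ov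
    half₂ : ∃ λ m → Odd m × sumSquares (re d) (im d) ≡ + 2 * m
    half₂ = sum-squares-half (≈-trans re-d ou) (≈-trans im-d ov)
    half₃ : ∃ λ m → Odd m × sumSquares (re G) (im G) ≡ + 2 * m
    half₃ = sum-squares-half (≈-trans re-G ou) (≈-trans im-G ov)
    m₁ m₂ m₃ : ℤ
    m₁ = proj₁ half₁
    m₂ = proj₁ half₂
    m₃ = proj₁ half₃
    o₁ = proj₁ (proj₂ half₁)
    o₂ = proj₁ (proj₂ half₂)
    o₃ = proj₁ (proj₂ half₃)
    eq′ : R * (+ 2 * m₁) * (+ 2 * m₂) * (+ 2 * m₃) ≡ + 64 * P
    eq′ = trans (sym (cong₂ _*_ (cong₂ _*_ (cong (R *_) (proj₂ (proj₂ half₁)))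
      (proj₂ (proj₂ half₂))) (proj₂ (proj₂ half₃)))) eq
    ring₁ : ∀ r a b c → r * (+ 2 * a) * (+ 2 * b) * (+ 2 * c) ≡ + 8 * r * b * c * a
    ring₁ = solve-∀
    ring₂ : ∀ r a b c → r * (+ 2 * a) * (+ 2 * b) * (+ 2 * c) ≡ + 8 * r * a * c * b
    ring₂ = solve-∀
    ring₃ : ∀ r a b c → r * (+ 2 * a) * (+ 2 * b) * (+ 2 * c) ≡ + 8 * r * a * b * c
    ring₃ = solve-∀
    k₁ : ±1-mod8 u × ±1-mod8 v
    k₁ = conclusive u v m₁ o₁ (+ 8 * R * m₂ * m₃ , trans (sym eq′) (ring₁ R m₁ m₂ m₃))
      (proj₂ (proj₂ half₁))
    k₂ : ±1-mod8 (re d) × ±1-mod8 (im d)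
    k₂ = conclusive (re d) (im d) m₂ o₂ (+ 8 * R * m₁ * m₃ , trans (sym eq′) (ring₂ R m₁ m₂ m₃))
      (proj₂ (proj₂ half₂))
    k₃ : ±1-mod8 (re G) × ±1-mod8 (im G)
    k₃ = conclusive (re G) (im G) m₃ o₃ (+ 8 * R * m₁ * m₂ , trans (sym eq′) (ring₃ R m₁ m₂ m₃))
      (proj₂ (proj₂ half₃))

values-impossible : ∀ a P → Odd P → Conclusive (+ 64 * P) → values a ≢ + 64 * P
values-impossible a = impossible (plus 8 a) (minus 8 a) λ i → minus≈plus (a (i ↑ˡ 8)) (a (8 ↑ʳ i))

-- Prime divisors of the products

module _ {ℓ} (pr : Prime ℓ) where
  prime∤1 : ¬ ℓ ℕ.∣ 1
  prime∤1 d = ¬prime[1] (subst Prime (ℕ.∣1⇒≡1 d) pr)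

  prime∣prime : ∀ {p} → Prime p → ℓ ℕ.∣ p → ℓ ≡ p
  prime∣prime pr′ d = [ (λ ℓ≡1 → contradiction (subst Prime ℓ≡1 pr) ¬prime[1]) , id ]′
    (prime⇒irreducible pr′ d)

  prime∣^ : ∀ p k → ℓ ℕ.∣ p ^ k → ℓ ℕ.∣ p
  prime∣^ p zero    d = contradiction d prime∤1
  prime∣^ p (suc k) d = [ id , prime∣^ p k ]′ (euclidsLemma p (p ^ k) pr d)

  prime∣prod : ∀ {n} (f : Fin n → ℕ) → ℓ ℕ.∣ prodFinℕ f → ∃ λ i → ℓ ℕ.∣ f i
  prime∣prod {zero}  f d = contradiction d prime∤1
  prime∣prod {suc n} f d = [ (λ d → zero , d) , (λ d → let i , d′ = prime∣prod (f ∘ suc) d in suc i , d′) ]′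
    (euclidsLemma (f zero) (prodFinℕ (f ∘ suc)) pr d)

  -- Two cancellations: ℓ ∣ uv gives v = wℓ, and then ℓ ∣ uw gives ℓ ∣ w.
  square∣coprimeˡ : ∀ u v → ¬ ℓ ℕ.∣ u → ℓ ℕ.* ℓ ℕ.∣ u ℕ.* v → ℓ ℕ.* ℓ ℕ.∣ v
  square∣coprimeˡ u v ℓ∤u d = square (other (ℕ.∣-trans (ℕ.m∣m*n ℓ) d))
    where
    instance
      ℓ≢0 : ℕ.NonZero ℓ
      ℓ≢0 = prime⇒nonZero pr
    other : ∀ {w} → ℓ ℕ.∣ u ℕ.* w → ℓ ℕ.∣ w
    other {w} d = [ (λ ℓ∣u → contradiction ℓ∣u ℓ∤u) , id ]′ (euclidsLemma u w pr d)
    square : ℓ ℕ.∣ v → ℓ ℕ.* ℓ ℕ.∣ v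
    square (ℕ.divides w refl) = ℕ.*-monoˡ-∣ ℓ (other (ℕ.*-cancelʳ-∣ ℓ
      (subst (ℓ ℕ.* ℓ ℕ.∣_) (sym (ℕ.*-assoc u w ℓ)) d)))

  square∤prod : ∀ {n} (q : Fin n → ℕ) → (∀ i → Prime (q i)) → Injective _≡_ _≡_ q →
                ¬ ℓ ℕ.* ℓ ℕ.∣ prodFinℕ q
  square∤prod {zero}  q prs inj d = prime∤1 (ℕ.∣-trans (ℕ.m∣m*n ℓ) d)
  square∤prod {suc n} q prs inj d with ℓ ℕ.∣? q zero
  ... | no ℓ∤q₀  = square∤prod (q ∘ suc) (prs ∘ suc) (Fin.suc-injective ∘ inj)
    (square∣coprimeˡ (q zero) (prodFinℕ (q ∘ suc)) ℓ∤q₀ d)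
  ... | yes ℓ∣q₀ = contradiction (inj (trans (sym ℓ≡q₀) (prime∣prime (prs (suc i)) ℓ∣qᵢ))) λ ()
    where
    ℓ≡q₀ : ℓ ≡ q zero
    ℓ≡q₀ = prime∣prime (prs zero) ℓ∣q₀
    rest : ∃ λ i → ℓ ℕ.∣ q (suc i)
    rest = prime∣prod (q ∘ suc) (ℕ.*-cancelˡ-∣ ℓ {{prime⇒nonZero pr}}
      (subst (λ x → ℓ ℕ.* ℓ ℕ.∣ x ℕ.* prodFinℕ (q ∘ suc)) (sym ℓ≡q₀) d))
    i = proj₁ rest
    ℓ∣qᵢ = proj₂ rest

Is8m±1⇒mod8 : ∀ {x} → Is8m±1 x → ±1-mod8 x
Is8m±1⇒mod8 (m , inj₁ e) = inj₁ (by m (trans e (ring m)))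
  where
  ring : ∀ m → + 8 * m + + 1 ≡ + 1 + m * + 8
  ring = solve-∀
Is8m±1⇒mod8 (m , inj₂ e) = inj₂ (by m (trans e (ring m)))
  where
  ring : ∀ m → + 8 * m - + 1 ≡ - + 1 + m * + 8
  ring = solve-∀

odd⇒2∤ : ∀ m → Odd m → ¬ 2 ℕ.∣ ∣ m ∣
odd⇒2∤ m o d = let divides q e = ∣ᵤ⇒∣ {+ 2} {m} d in
  even×odd⇒⊥ (by q (trans e (sym (ℤ.+-identityˡ (q * + 2))))) o

2∤⇒odd : ∀ n → ¬ 2 ℕ.∣ n → Odd (+ n)
2∤⇒odd n 2∤n = [ (λ (by q e) → contradiction
  (∣⇒∣ᵤ {+ 2} {+ n} (divides q (trans e (ℤ.+-identityˡ (q * + 2))))) 2∤n) , id ]′ (even-or-odd (+ n))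

-- The divisor m is automatically non-negative, since 2m is a sum of two squares.
conclusive : ∀ z → (∀ m → m ℕ.∣ ∣ z ∣ → ¬ 2 ℕ.∣ m → Admissible m) → Conclusive z
conclusive z adm x y (+ m) o (n , e) eq =
  let kx , ky = represented m {{ℕ.≢-nonZero λ { refl → odd⇒2∤ (+ 0) o (2 ℕ.∣0) }}}
        (adm m (∣⇒∣ᵤ {+ m} {z} (divides n e)) (odd⇒2∤ (+ m) o)) x y eq
  in Is8m±1⇒mod8 kx , Is8m±1⇒mod8 ky
conclusive z adm x y -[1+ m ] o _ eq = contradiction
  (trans (sym (cong₂ _+_ (square-abs x) (square-abs y))) eq) λ ()

self-or-neg : ∀ x n → ∣ x ∣ ≡ n → x ≡ + n ⊎ x ≡ - + n
self-or-neg (+ n)    _ refl = inj₁ refl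
self-or-neg -[1+ n ] _ refl = inj₂ refl

square-cancel : ∀ m n → m ℕ.* m ≡ n ℕ.* n → m ≡ n
square-cancel m n e with ℕ.<-cmp m n
... | tri< m<n _ _ = contradiction e (ℕ.<⇒≢ (ℕ.*-mono-< m<n m<n))
... | tri≈ _ m≡n _ = m≡n
... | tri> _ _ n<m = contradiction (sym e) (ℕ.<⇒≢ (ℕ.*-mono-< n<m n<m))

-- Equality of squares leaves `values a` = ±64n. The sign is absorbed into the odd number P = ±n, on
-- which `values-impossible` puts no sign condition.
64*-not-in-S16 : ∀ n → ¬ 2 ℕ.∣ n → (∀ m → m ℕ.∣ 64 ℕ.* n → ¬ 2 ℕ.∣ m → Admissible m) → ¬ InS16 (+ (64 ℕ.* n))
64*-not-in-S16 n 2∤n adm (a , D≡) =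
  [ (λ e → excluded (+ n) (2∤⇒odd n 2∤n) refl (trans e (ℤ.pos-* 64 n)))
  , (λ e → excluded (- + n) (≈-trans (≈-neg (2∤⇒odd n 2∤n)) (by (- + 1) refl)) (ℤ.∣-i∣≡∣i∣ (+ n))
      (trans e (trans (cong -_ (ℤ.pos-* 64 n)) (ℤ.neg-distribʳ-* (+ 64) (+ n)))))
  ]′ (self-or-neg (values a) (64 ℕ.* n) (square-cancel ∣ values a ∣ (64 ℕ.* n) abs-square))
  where
  abs-square : ∣ values a ∣ ℕ.* ∣ values a ∣ ≡ 64 ℕ.* n ℕ.* (64 ℕ.* n)
  abs-square = ℤ.+-injective (begin
    + (∣ values a ∣ ℕ.* ∣ values a ∣)      ≡⟨ square-abs (values a) ⟨
    values a * values a                    ≡⟨ D16-square a ⟨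
    D16 a * D16 a                          ≡⟨ cong (λ x → x * x) D≡ ⟩
    + (64 ℕ.* n) * + (64 ℕ.* n)            ≡⟨ ℤ.pos-* (64 ℕ.* n) (64 ℕ.* n) ⟨
    + (64 ℕ.* n ℕ.* (64 ℕ.* n))            ∎)
    where open ≡-Reasoning
  excluded : ∀ P → Odd P → ∣ P ∣ ≡ n → values a ≢ + 64 * P
  excluded P oP ∣P∣≡n = values-impossible a P oP (conclusive (+ 64 * P)
    (subst (λ z → ∀ m → m ℕ.∣ z → ¬ 2 ℕ.∣ m → Admissible m)
      (sym (trans (ℤ.abs-* (+ 64) P) (cong (64 ℕ.*_) ∣P∣≡n))) adm))

module _ (r s : ℕ) (p : Fin (r ℕ.+ s) → ℕ) (k : Fin (r ℕ.+ s) → ℕ)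
  (special : ∀ (i : Fin r) → SpecialPrime (p (i ↑ˡ s)))
  (seven : ∀ (j : Fin s) → Prime (p (r ↑ʳ j)) × (p (r ↑ʳ j) % 8 ≡ 7)) where

  A = prodFinℕ λ i → p i ^ k i

  prime-of-A : ∀ {ℓ} → Prime ℓ → ℓ ℕ.∣ A → SpecialPrime ℓ ⊎ ℓ % 8 ≡ 7
  prime-of-A {ℓ} pr d = let i , ℓ∣pᵢ^k = prime∣prod pr (λ i → p i ^ k i) d in
    at (splitAt r i) (subst (λ j → ℓ ℕ.∣ p j) (sym (Fin.join-splitAt r s i)) (prime∣^ pr (p i) (k i) ℓ∣pᵢ^k))
    where
    at : ∀ x → ℓ ℕ.∣ p (join r s x) → SpecialPrime ℓ ⊎ ℓ % 8 ≡ 7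
    at (inj₁ i) d = inj₁ (subst SpecialPrime (sym (prime∣prime pr (proj₁ (special i)) d)) (special i))
    at (inj₂ j) d = inj₂ (subst (λ x → x % 8 ≡ 7) (sym (prime∣prime pr (proj₁ (seven j)) d)) (proj₂ (seven j)))

  module _ (t : ℕ) (q : Fin t → ℕ) (three : ∀ (l : Fin t) → Prime (q l) × (q l % 8 ≡ 3))
    (inj : Injective _≡_ _≡_ q) where

    B = prodFinℕ q

    prime-of-B : ∀ {ℓ} → Prime ℓ → ℓ ℕ.∣ B → ℓ % 8 ≡ 3
    prime-of-B pr d = let l , ℓ∣q = prime∣prod pr q d in
      subst (λ x → x % 8 ≡ 3) (sym (prime∣prime pr (proj₁ (three l)) ℓ∣q)) (proj₂ (three l))

    A-residue : ∀ {ℓ} → Prime ℓ → ℓ ℕ.∣ A → ℓ % 8 ≡ 1 ⊎ ℓ % 8 ≡ 7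
    A-residue pr d = Sum.map₁ (proj₁ ∘ proj₂) (prime-of-A pr d)

    2∤A*B : ¬ 2 ℕ.∣ A ℕ.* B
    2∤A*B d = [ (λ d → [ (λ ()) , (λ ()) ]′ (A-residue prime[2] d))
              , (λ d → contradiction (prime-of-B prime[2] d) λ ()) ]′ (euclidsLemma A B prime[2] d)

    -- A prime ℓ dividing B divides neither 64 nor A, by its residue modulo 8, so ℓ² ∣ m would put
    -- ℓ² into B, a product of distinct primes.
    admissible : ∀ m → m ℕ.∣ 64 ℕ.* (A ℕ.* B) → ¬ 2 ℕ.∣ m → Admissible m
    admissible m m∣N 2∤m ℓ pr ℓ∣m =
      [ (λ d → contradiction d ℓ∤64) , (λ d → [ from-A , from-B ]′ (euclidsLemma A B pr d)) ]′
      (euclidsLemma 64 (A ℕ.* B) pr (ℕ.∣-trans ℓ∣m m∣N))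
      where
      ℓ∤64 : ¬ ℓ ℕ.∣ 64
      ℓ∤64 d = 2∤m (subst (ℕ._∣ m) (prime∣prime pr prime[2] (prime∣^ pr 2 6 d)) ℓ∣m)
      mod4 : ∀ {x} → ℓ % 8 ≡ x → ℓ % 4 ≡ x % 4
      mod4 e = trans (sym (ℕ.m∣n⇒o%n%m≡o%m 4 8 ℓ (ℕ.divides 2 refl))) (cong (_% 4) e)
      from-A : ℓ ℕ.∣ A → _
      from-A d = Sum.map₂ (λ ℓ≡7 → mod4 ℓ≡7 , inj₁ ℓ≡7) (prime-of-A pr d)
      from-B : ℓ ℕ.∣ B → _
      from-B d = inj₂ (mod4 ℓ≡3 , inj₂ λ ℓ²∣m → square∤prod pr q (proj₁ ∘ three) inj
        (square∣coprimeˡ pr A B ℓ∤A (square∣coprimeˡ pr 64 (A ℕ.* B) ℓ∤64 (ℕ.∣-trans ℓ²∣m m∣N))))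
        where
        ℓ≡3 = prime-of-B pr d
        ℓ∤A : ¬ ℓ ℕ.∣ A
        ℓ∤A d′ = [ (λ e → contradiction (trans (sym e) ℓ≡3) λ ())
                 , (λ e → contradiction (trans (sym e) ℓ≡3) λ ()) ]′ (A-residue pr d′)

    64*A*B∉S16 : ¬ InS16 (+ (64 ℕ.* (A ℕ.* B)))
    64*A*B∉S16 = 64*-not-in-S16 (A ℕ.* B) 2∤A*B admissible

theorem4p1 : (r s t : ℕ) (p : Fin (r ℕ.+ s) → ℕ) (q : Fin t → ℕ) (k : Fin (r ℕ.+ s) → ℕ) →
    (∀ (i : Fin r) → SpecialPrime (p (i ↑ˡ s))) →
    (∀ (j : Fin s) → Prime (p (r ↑ʳ j)) × (p (r ↑ʳ j) % 8 ≡ 7)) →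
    (∀ (l : Fin t) → Prime (q l) × (q l % 8 ≡ 3)) →
    Injective _≡_ _≡_ q →
    ¬ InS16 (+ (64 ℕ.* prodFinℕ (λ i → p i ^ k i))) ×
    ¬ InS16 (+ (64 ℕ.* prodFinℕ (λ i → p i ^ k i) ℕ.* prodFinℕ q))
theorem4p1 r s t p q k special seven three inj =
  -- The first claim is the case t = 0, where B is the empty product.
  subst (λ n → ¬ InS16 (+ (64 ℕ.* n))) (ℕ.*-identityʳ A′)
    (64*A*B∉S16 r s p k special seven 0 (λ ()) (λ ()) (λ { {()} })) ,
  subst (λ n → ¬ InS16 (+ n)) (sym (ℕ.*-assoc 64 A′ (prodFinℕ q)))
    (64*A*B∉S16 r s p k special seven t q three inj)
  where
  A′ = prodFinℕ λ i → p i ^ k i
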